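{- For each of the following four lattices: the quadratic lattice, the crossed quadratic lattice, the generalized aztec diamond lattice, and the 8.8.4 lattice, the entropy constant is the same whether the lattice is on the plane, the cylinder or the torus. That is, if $G_{m,n}$, $H_{n,m}$, $S_{n,m}$ denote the corresponding plane, cylindrical and toroidal lattice graphs and $i(\cdot)$ denotes the number of independent sets, then the limits $$\lim_{m,n\to\infty} i(G_{m,n})^{1/|V(G_{m,n})|},\qquad \lim_{m,n\to\infty} i(H_{n,m})^{1/|V(H_{n,m})|},\qquad \lim_{m,n\to\infty} i(S_{n,m})^{1/|V(S_{n,m})|}$$ exist and are equal.
   Context: Independent sets include the empty set; the limits are double limits with $m,n\to\infty$ independently. In each case $H_{n,m}$ is the quotient of $G_{m,n}$ identifying the leftmost column of vertices with the rightmost one, and $S_{n,m}$ is the quotient of $H_{n,m}$ identifying also the top row with the bottom row, as specified below. Multiple edges are irrelevant, and a vertex carrying a loop (possible only for small $m,n$) belongs to no independent set. Quadratic lattice: $G_{m,n}$ has vertices $(i,j)$, $0\le i\le m$, $0\le j\le n$, with $(i,j)$ adjacent to $(i',j')$ iff $|i-i'|+|j-j'|=1$. Crossed quadratic lattice: same vertices, with $(i,j)\ne(i',j')$ adjacent iff $|i-i'|\le 1$ and $|j-j'|\le 1$ (both diagonals added in each square). In both cases $H_{n,m}$ identifies $(i,0)\sim(i,n)$ for all $i$, and $S_{n,m}$ identifies in addition $(0,j)\sim(m,j)$ for all $j$. Generalized aztec diamond of order $m\times n$: $G_{m,n}$ has vertices $(x,y)$ with $1\le x\le 2m+1$, $1\le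 y\le 2n+1$, $x+y$ odd, with $(x,y)$ adjacent to $(x',y')$ iff $|x-x'|=|y-y'|=1$. $H_{n,m}$ identifies $(x,1)\sim(x,2n+1)$ for all $x$; $S_{n,m}$ identifies in addition $(1,y)\sim(2m+1,y)$ for all $y$. 8.8.4 lattice ($m,n\ge 2$): $G_{m,n}$ is built from squares (4-cycles) indexed by $(a,b)$, $1\le a\le m$, $1\le b\le n$, with vertices $U(a,b)$ (up, present iff $a\ge 2$), $D(a,b)$ (down, present iff $a\le m-1$), $L(a,b)$ (left, present iff $b\ge 2$), $R(a,b)$ (right, present iff $b\le n-1$). Edges: for each $(a,b)$, each of $U(a,b),D(a,b)$ is adjacent to each of $L(a,b),R(a,b)$ (when present); $D(a,b)$ is adjacent to $U(a+1,b)$; $R(a,b)$ is adjacent to $L(a,b+1)$. It has $4mn-2m-2n$ vertices. $H_{n,m}$ identifies $U(a,1)\sim U(a,n)$ and $D(a,1)\sim D(a,n)$ for all $a$; $S_{n,m}$ identifies in addition $L(1,b)\sim L(m,b)$ and $R(1,b)\sim R(m,b)$ for all $b$. -}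

module Defs where

open import Data.Empty using (⊥)
import Data.Integer.Base as ℤ
import Data.Integer.Properties as ℤ
open import Data.List.Base
  using (List; []; _∷_; _++_; map; filter; length; upTo; cartesianProduct; deduplicate)
open import Data.List.Relation.Unary.All using (All; []; _∷_; all?)
open import Data.List.Relation.Unary.AllPairs using ([]; _∷_)
open import Data.List.Relation.Unary.Any using (Any; any?)
open import Data.List.Membership.Propositional using (find; lose)
open import Data.List.Relation.Unary.Unique.Propositional using (Unique)
import Data.List.Relation.Unary.Unique.Propositional.Properties as Unique
import Data.List.Relation.Unary.Unique.DecPropositional.Properties as DecUnique
open import Data.Nat.Base
open import Data.Nat.Properties
open import Data.Product using (_×_; _,_; ∃-syntax)
open import Data.Product.Properties using (≡-dec)
open import Data.Rational.Unnormalised.Base as ℚ using (ℚᵘ; 0ℚᵘ)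
import Data.Rational.Unnormalised.Properties as ℚ
open import Data.Rational.Unnormalised.Solver using (module +-*-Solver)
open import Data.Sum using (_⊎_; inj₁; inj₂; swap)
open import Relation.Binary.Core using (Rel)
open import Relation.Binary.Definitions using (Decidable; DecidableEquality; Symmetric)
open import Relation.Binary.PropositionalEquality
open import Relation.Nullary using (¬_; yes; no)
open import Relation.Nullary.Decidable using (¬?; _×-dec_; _⊎-dec_)
import Relation.Unary as Unary

-- Bishop's reals: regular sequences of rationals.  The n-th term is within
-- 1/(n+1) of the real number represented.

record ℝ : Set where
  field
    approx  : ℕ → ℚᵘ
    regular : ∀ m n → ℚ.∣ approx m ℚ.- approx n ∣ ℚ.≤
                      (ℤ.+ 1 ℚ./ suc m) ℚ.+ (ℤ.+ 1 ℚ./ suc n)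

open ℝ public

infix  4 _≤ℝ_
infixl 6 _-ℝ_

-- As the terms at n of x and of y carry an error of 1/(n+1) each, this is
-- Bishop's order and not the pointwise one.

_≤ℝ_ : Rel ℝ _
x ≤ℝ y = ∀ n → approx x n ℚ.≤ approx y n ℚ.+ (ℤ.+ 2 ℚ./ suc n)

private
  module _ where
    open +-*-Solver

    ≤+⇒-≤ : ∀ p q e → p ℚ.≤ q ℚ.+ e → p ℚ.- q ℚ.≤ e
    ≤+⇒-≤ p q e p≤q+e = ℚ.≤-respʳ-≃
      (solve 2 (λ q e → (q :+ e) :- q := e) ℚ.≃-refl q e)
      (ℚ.+-monoˡ-≤ (ℚ.- q) p≤q+e)

    neg-minus : ∀ p q → ℚ.- (p ℚ.- q) ℚ.≃ q ℚ.- p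
    neg-minus = solve 2 (λ p q → :- (p :- q) := q :- p) ℚ.≃-refl

    minus-interchange : ∀ a b c d → (a ℚ.- b) ℚ.- (c ℚ.- d) ℚ.≃ (a ℚ.- c) ℚ.- (b ℚ.- d)
    minus-interchange =
      solve 4 (λ a b c d → (a :- b) :- (c :- d) := (a :- c) :- (b :- d)) ℚ.≃-refl

    plus-interchange : ∀ a b → (a ℚ.+ b) ℚ.+ (a ℚ.+ b) ℚ.≃ (a ℚ.+ a) ℚ.+ (b ℚ.+ b)
    plus-interchange = solve 2 (λ a b → (a :+ b) :+ (a :+ b) := (a :+ a) :+ (b :+ b)) ℚ.≃-refl

  ∣∣≤ : ∀ p {e} → p ℚ.≤ e → ℚ.- p ℚ.≤ e → ℚ.∣ p ∣ ℚ.≤ e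
  ∣∣≤ p p≤e -p≤e with ℚ.∣p∣≡p∨∣p∣≡-p p
  ... | inj₁ eq = subst (ℚ._≤ _) (sym eq) p≤e
  ... | inj₂ eq = subst (ℚ._≤ _) (sym eq) -p≤e

  ∣p∣-∣q∣≤∣p-q∣ : ∀ p q → ℚ.∣ p ∣ ℚ.- ℚ.∣ q ∣ ℚ.≤ ℚ.∣ p ℚ.- q ∣
  ∣p∣-∣q∣≤∣p-q∣ p q = ≤+⇒-≤ _ _ _ (ℚ.≤-trans
    (ℚ.≤-reflexive (ℚ.∣-∣-cong
      (solve 2 (λ p q → p := q :+ (p :- q)) ℚ.≃-refl p q)))
    (ℚ.∣p+q∣≤∣p∣+∣q∣ q (p ℚ.- q)))
    where open +-*-Solver

  ∣∣p∣-∣q∣∣≤∣p-q∣ : ∀ p q → ℚ.∣ ℚ.∣ p ∣ ℚ.- ℚ.∣ q ∣ ∣ ℚ.≤ ℚ.∣ p ℚ.- q ∣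
  ∣∣p∣-∣q∣∣≤∣p-q∣ p q = ∣∣≤ (ℚ.∣ p ∣ ℚ.- ℚ.∣ q ∣) (∣p∣-∣q∣≤∣p-q∣ p q)
    (ℚ.≤-respˡ-≃ (ℚ.≃-sym (neg-minus ℚ.∣ p ∣ ℚ.∣ q ∣))
      (ℚ.≤-respʳ-≃ (ℚ.≃-trans (ℚ.∣-∣-cong (ℚ.≃-sym (neg-minus p q))) (ℚ.∣-p∣≃∣p∣ (p ℚ.- q)))
        (∣p∣-∣q∣≤∣p-q∣ q p)))

  p-p≃0 : ∀ p → ℚ.∣ p ℚ.- p ∣ ℚ.≃ 0ℚᵘ
  p-p≃0 p = ℚ.∣-∣-cong (ℚ.+-inverseʳ p)

  half+half : ∀ m → (ℤ.+ 1 ℚ./ suc (suc (2 * m))) ℚ.+ (ℤ.+ 1 ℚ./ suc (suc (2 * m)))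
                    ℚ.≃ ℤ.+ 1 ℚ./ suc m
  half+half m = ℚ.*≡* (cong ℤ.+_ (begin
    (1 * k + 1 * k) * suc m  ≡⟨ cong (λ z → (z + z) * suc m) (*-identityˡ k) ⟩
    (k + k) * suc m          ≡⟨ lemma ⟩
    k * k                    ≡⟨ sym (*-identityˡ (k * k)) ⟩
    1 * (k * k)              ∎))
    where
    open ≡-Reasoning
    k = suc (suc (2 * m))
    k≡2[1+m] : k ≡ 2 * suc m
    k≡2[1+m] = sym (*-suc 2 m)
    lemma : (k + k) * suc m ≡ k * k
    lemma = begin
      (k + k) * suc m      ≡⟨ cong (λ z → (k + z) * suc m) (sym (+-identityʳ k)) ⟩
      (2 * k) * suc m      ≡⟨ cong (_* suc m) (*-comm 2 k) ⟩
      (k * 2) * suc m      ≡⟨ *-assoc k 2 (suc m) ⟩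
      k * (2 * suc m)      ≡⟨ cong (k *_) (sym k≡2[1+m]) ⟩
      k * k                ∎

fromℚ : ℚᵘ → ℝ
fromℚ p .approx  _   = p
fromℚ p .regular m n = ℚ.≤-respˡ-≃ (ℚ.≃-sym (p-p≃0 p)) (ℚ.nonNegative⁻¹ _)

∣_∣ℝ : ℝ → ℝ
∣ x ∣ℝ .approx  n   = ℚ.∣ approx x n ∣
∣ x ∣ℝ .regular m n = ℚ.≤-trans (∣∣p∣-∣q∣∣≤∣p-q∣ (approx x m) (approx x n)) (regular x m n)

-- Subtraction adds the two errors, so the terms are taken at index 2n+1.

_-ℝ_ : ℝ → ℝ → ℝ
(x -ℝ y) .approx  n   = approx x (suc (2 * n)) ℚ.- approx y (suc (2 * n))
(x -ℝ y) .regular m n = begin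
  ℚ.∣ (x′ m ℚ.- y′ m) ℚ.- (x′ n ℚ.- y′ n) ∣
    ≃⟨ ℚ.∣-∣-cong (minus-interchange (x′ m) (y′ m) (x′ n) (y′ n)) ⟩
  ℚ.∣ (x′ m ℚ.- x′ n) ℚ.- (y′ m ℚ.- y′ n) ∣
    ≤⟨ ℚ.∣p-q∣≤∣p∣+∣q∣ (x′ m ℚ.- x′ n) (y′ m ℚ.- y′ n) ⟩
  ℚ.∣ x′ m ℚ.- x′ n ∣ ℚ.+ ℚ.∣ y′ m ℚ.- y′ n ∣
    ≤⟨ ℚ.+-mono-≤ (regular x (suc (2 * m)) (suc (2 * n)))
                  (regular y (suc (2 * m)) (suc (2 * n))) ⟩
  (e m ℚ.+ e n) ℚ.+ (e m ℚ.+ e n)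
    ≃⟨ plus-interchange (e m) (e n) ⟩
  (e m ℚ.+ e m) ℚ.+ (e n ℚ.+ e n)
    ≃⟨ ℚ.+-cong (half+half m) (half+half n) ⟩
  (ℤ.+ 1 ℚ./ suc m) ℚ.+ (ℤ.+ 1 ℚ./ suc n) ∎
  where
  open ℚ.≤-Reasoning
  x′ y′ e : ℕ → ℚᵘ
  x′ k = approx x (suc (2 * k))
  y′ k = approx y (suc (2 * k))
  e  k = ℤ.+ 1 ℚ./ suc (suc (2 * k))

-- greatestRoot k X b is the greatest a ≤ b with a ^ k ≤ X, for k ≥ 1.

greatestRoot : ℕ → ℕ → ℕ → ℕ
greatestRoot k X zero    = zero
greatestRoot k X (suc b) with suc b ^ k ≤? X
... | yes _ = suc b
... | no  _ = greatestRoot k X b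

-- The integer part of the k-th root of X, for k ≥ 1.

floorRoot : ℕ → ℕ → ℕ
floorRoot k X = greatestRoot k X X

private
  greatestRoot-lower : ∀ k X b → greatestRoot (suc k) X b ^ suc k ≤ X
  greatestRoot-lower k X zero    = z≤n
  greatestRoot-lower k X (suc b) with suc b ^ suc k ≤? X
  ... | yes p = p
  ... | no  _ = greatestRoot-lower k X b

  greatestRoot-upper : ∀ k X b → X < suc b ^ suc k → X < suc (greatestRoot (suc k) X b) ^ suc k
  greatestRoot-upper k X zero    X<1 = X<1
  greatestRoot-upper k X (suc b) X<  with suc b ^ suc k ≤? X
  ... | yes _ = X<
  ... | no ¬p = greatestRoot-upper k X b (≰⇒> ¬p)

floorRoot-lower : ∀ k X → floorRoot (suc k) X ^ suc k ≤ X
floorRoot-lower k X = greatestRoot-lower k X X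

floorRoot-upper : ∀ k X → X < suc (floorRoot (suc k) X) ^ suc k
floorRoot-upper k X = greatestRoot-upper k X X (m≤m*n (suc X) (suc X ^ k) {{m^n≢0 (suc X) k}})

private
  ^-distribʳ-* : ∀ k a b → (a * b) ^ k ≡ a ^ k * b ^ k
  ^-distribʳ-* zero    a b = refl
  ^-distribʳ-* (suc k) a b = begin
    a * b * (a * b) ^ k        ≡⟨ cong (a * b *_) (^-distribʳ-* k a b) ⟩
    a * b * (a ^ k * b ^ k)    ≡⟨ [m*n]*[o*p]≡[m*o]*[n*p] a b (a ^ k) (b ^ k) ⟩
    a * a ^ k * (b * b ^ k)    ∎
    where open ≡-Reasoning

  ^-cancel-< : ∀ k {a b} → a ^ k < b ^ k → a < b
  ^-cancel-< k a^k<b^k = ≰⇒> λ b≤a → <⇒≱ a^k<b^k (^-monoˡ-≤ k b≤a)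

  rootApprox : ℕ → ℕ → ℕ → ℕ
  rootApprox k x n = floorRoot (suc k) (x * suc n ^ suc k)

  rootApprox-≤ : ∀ k x m n → rootApprox k x m * suc n ≤ suc (rootApprox k x n) * suc m
  rootApprox-≤ k x m n = <⇒≤ (^-cancel-< (suc k) (begin-strict
    (a * N) ^ K            ≡⟨ ^-distribʳ-* K a N ⟩
    a ^ K * N ^ K          ≤⟨ *-monoˡ-≤ (N ^ K) (floorRoot-lower k (x * M ^ K)) ⟩
    x * M ^ K * N ^ K      ≡⟨ *-assoc x (M ^ K) (N ^ K) ⟩
    x * (M ^ K * N ^ K)    ≡⟨ cong (x *_) (*-comm (M ^ K) (N ^ K)) ⟩
    x * (N ^ K * M ^ K)    ≡⟨ *-assoc x (N ^ K) (M ^ K) ⟨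
    x * N ^ K * M ^ K      <⟨ *-monoˡ-< (M ^ K) {{m^n≢0 M K}} (floorRoot-upper k (x * N ^ K)) ⟩
    suc b ^ K * M ^ K      ≡⟨ ^-distribʳ-* K (suc b) M ⟨
    (suc b * M) ^ K        ∎))
    where
    open ≤-Reasoning
    K = suc k
    M = suc m
    N = suc n
    a = rootApprox k x m
    b = rootApprox k x n

  rootApprox-≤ℚ : ∀ k x m n → (ℤ.+ rootApprox k x m ℚ./ suc m) ℚ.≤
                  (ℤ.+ rootApprox k x n ℚ./ suc n) ℚ.+ (ℤ.+ 1 ℚ./ suc n)
  rootApprox-≤ℚ k x m n = ℚ.≤-trans
    (ℚ.*≤* {q = ℤ.+ suc b ℚ./ suc n}
      (subst₂ ℤ._≤_ (ℤ.pos-* a (suc n)) (ℤ.pos-* (suc b) (suc m))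
        (ℤ.+≤+ (rootApprox-≤ k x m n))))
    (ℚ.≤-reflexive (ℚ.*≡* (trans (sym (ℤ.pos-* (suc b) (suc n * suc n)))
      (trans (cong ℤ.+_ eq) (trans (ℤ.pos-* (b * suc n + 1 * suc n) (suc n))
        (cong (ℤ._* (ℤ.+ suc n)) (trans (ℤ.pos-+ (b * suc n) (1 * suc n))
          (cong₂ ℤ._+_ (ℤ.pos-* b (suc n)) (ℤ.pos-* 1 (suc n))))))))))
    where
    a = rootApprox k x m
    b = rootApprox k x n
    eq : suc b * (suc n * suc n) ≡ (b * suc n + 1 * suc n) * suc n
    eq = trans (sym (*-assoc (suc b) (suc n) (suc n)))
      (cong (_* suc n) (trans (cong (_* suc n) (+-comm 1 b)) (*-distribʳ-+ (suc n) b 1)))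

-- root k x is x^(1/k): its n-th term is the greatest fraction with
-- denominator n+1 that does not exceed x^(1/k).  There is no 0-th root;
-- root 0 x is a dummy value.

root : ℕ → ℕ → ℝ
root zero    x = fromℚ 0ℚᵘ
root (suc k) x .approx  n   = ℤ.+ floorRoot (suc k) (x * suc n ^ suc k) ℚ./ suc n
root (suc k) x .regular m n = ∣∣≤ (p ℚ.- q)
  (ℚ.≤-trans (≤+⇒-≤ p q (ℤ.+ 1 ℚ./ suc n) (rootApprox-≤ℚ k x m n))
             (ℚ.p≤q+p (ℤ.+ 1 ℚ./ suc n) (ℤ.+ 1 ℚ./ suc m)))
  (ℚ.≤-respˡ-≃ (ℚ.≃-sym (neg-minus p q))
    (ℚ.≤-trans (≤+⇒-≤ q p (ℤ.+ 1 ℚ./ suc m) (rootApprox-≤ℚ k x n m))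
               (ℚ.p≤p+q (ℤ.+ 1 ℚ./ suc m) (ℤ.+ 1 ℚ./ suc n))))
  where
  p = ℤ.+ rootApprox k x m ℚ./ suc m
  q = ℤ.+ rootApprox k x n ℚ./ suc n

-- The two indices tend to infinity independently of each other.

infix 4 _⟶_

_⟶_ : (ℕ → ℕ → ℝ) → ℝ → Set
f ⟶ ℓ = ∀ ε → 0ℚᵘ ℚ.< ε →
        ∃[ N ] (∀ m n → N ≤ m → N ≤ n → ∣ f m n -ℝ ℓ ∣ℝ ≤ℝ fromℚ ε)

-- The vertices are the elements of the list; only the values of Adj on them
-- matter.  Loops are allowed.

record Graph (V : Set) : Set₁ where
  field
    vertices : List V
    unique   : Unique vertices
    Adj      : Rel V _
    adj?     : Decidable Adj
    adj-sym  : Symmetric Adj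

open Graph public

∣V_∣ : ∀ {V} → Graph V → ℕ
∣V G ∣ = length (vertices G)

-- Comparing a vertex with itself excludes the vertices carrying a loop.

Independent : ∀ {V} → Graph V → List V → Set
Independent G S = All (λ u → All (λ v → ¬ Adj G u v) S) S

independent? : ∀ {V} (G : Graph V) → Unary.Decidable (Independent G)
independent? G S = all? (λ u → all? (λ v → ¬? (adj? G u v)) S) S

-- As the entries of the list are distinct, each subset is listed once.

subsets : {A : Set} → List A → List (List A)
subsets []       = [] ∷ []
subsets (x ∷ xs) = map (x ∷_) (subsets xs) ++ subsets xs

i : ∀ {V} → Graph V → ℕ
i G = length (filter (independent? G) (subsets (vertices G)))

-- The quotient identifying u and v whenever f u ≡ f v, with the class of u
-- represented by f u.  Two classes are adjacent when they have adjacent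
-- members.

quotient : {V W : Set} → DecidableEquality W → (V → W) → Graph V → Graph W
quotient _≟′_ f G .vertices = deduplicate _≟′_ (map f (vertices G))
quotient _≟′_ f G .unique   = DecUnique.deduplicate-! _≟′_ (map f (vertices G))
quotient _≟′_ f G .Adj x y  =
  Any (λ u → Any (λ v → f u ≡ x × f v ≡ y × Adj G u v) (vertices G)) (vertices G)
quotient _≟′_ f G .adj? x y =
  any? (λ u → any? (λ v → (f u ≟′ x) ×-dec (f v ≟′ y) ×-dec adj? G u v) (vertices G)) (vertices G)
quotient _≟′_ f G .adj-sym x~y with find x~y
... | u , u∈ , x~y′ with find x~y′
...   | v , v∈ , fu≡x , fv≡y , u~v = lose v∈ (lose u∈ (fv≡y , fu≡x , adj-sym G u~v))

data Lattice : Set where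
  quadratic crossedQuadratic aztecDiamond eightEightFour : Lattice

-- The vertices U(a,b), D(a,b), L(a,b), R(a,b) of the squares of the 8.8.4
-- lattice are (U , a , b), and so on.

data Direction : Set where
  U D L R : Direction

Site : Lattice → Set
Site quadratic        = ℕ × ℕ
Site crossedQuadratic = ℕ × ℕ
Site aztecDiamond     = ℕ × ℕ
Site eightEightFour   = Direction × ℕ × ℕ

directions : List Direction
directions = U ∷ D ∷ L ∷ R ∷ []

directions-unique : Unique directions
directions-unique =
  ((λ ()) ∷ (λ ()) ∷ (λ ()) ∷ []) ∷ ((λ ()) ∷ (λ ()) ∷ []) ∷ ((λ ()) ∷ []) ∷ [] ∷ []

infix 4 _≟ᵈ_

_≟ᵈ_ : DecidableEquality Direction
U ≟ᵈ U = yes refl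
U ≟ᵈ D = no λ ()
U ≟ᵈ L = no λ ()
U ≟ᵈ R = no λ ()
D ≟ᵈ U = no λ ()
D ≟ᵈ D = yes refl
D ≟ᵈ L = no λ ()
D ≟ᵈ R = no λ ()
L ≟ᵈ U = no λ ()
L ≟ᵈ D = no λ ()
L ≟ᵈ L = yes refl
L ≟ᵈ R = no λ ()
R ≟ᵈ U = no λ ()
R ≟ᵈ D = no λ ()
R ≟ᵈ L = no λ ()
R ≟ᵈ R = yes refl

siteEq? : ∀ Λ → DecidableEquality (Site Λ)
siteEq? quadratic        = ≡-dec _≟_ _≟_
siteEq? crossedQuadratic = ≡-dec _≟_ _≟_
siteEq? aztecDiamond     = ≡-dec _≟_ _≟_
siteEq? eightEightFour   = ≡-dec _≟ᵈ_ (≡-dec _≟_ _≟_)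

oneTo : ℕ → List ℕ
oneTo n = map suc (upTo n)

oneTo-unique : ∀ n → Unique (oneTo n)
oneTo-unique n = Unique.map⁺ suc-injective (Unique.upTo⁺ n)

grid : ℕ → ℕ → Graph (ℕ × ℕ)
grid m n .vertices = cartesianProduct (upTo (suc m)) (upTo (suc n))
grid m n .unique   = Unique.cartesianProduct⁺ (Unique.upTo⁺ (suc m)) (Unique.upTo⁺ (suc n))
grid m n .Adj  (i , j) (i′ , j′) = ∣ i - i′ ∣ + ∣ j - j′ ∣ ≡ 1
grid m n .adj? (i , j) (i′ , j′) = ∣ i - i′ ∣ + ∣ j - j′ ∣ ≟ 1
grid m n .adj-sym {i , j} {i′ , j′} eq =
  trans (cong₂ _+_ (∣-∣-comm i′ i) (∣-∣-comm j′ j)) eq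

crossedGrid : ℕ → ℕ → Graph (ℕ × ℕ)
crossedGrid m n .vertices = cartesianProduct (upTo (suc m)) (upTo (suc n))
crossedGrid m n .unique   = Unique.cartesianProduct⁺ (Unique.upTo⁺ (suc m)) (Unique.upTo⁺ (suc n))
crossedGrid m n .Adj  (i , j) (i′ , j′) =
  (i , j) ≢ (i′ , j′) × ∣ i - i′ ∣ ≤ 1 × ∣ j - j′ ∣ ≤ 1
crossedGrid m n .adj? (i , j) (i′ , j′) =
  ¬? (≡-dec _≟_ _≟_ (i , j) (i′ , j′)) ×-dec (∣ i - i′ ∣ ≤? 1) ×-dec (∣ j - j′ ∣ ≤? 1)
crossedGrid m n .adj-sym {i , j} {i′ , j′} (≢ , i~ , j~) =
  ≢-sym ≢ , subst (_≤ 1) (∣-∣-comm i i′) i~ , subst (_≤ 1) (∣-∣-comm j j′) j~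

aztec : ℕ → ℕ → Graph (ℕ × ℕ)
aztec m n .vertices = filter (λ (x , y) → (x + y) % 2 ≟ 1)
                             (cartesianProduct (oneTo (2 * m + 1)) (oneTo (2 * n + 1)))
aztec m n .unique   = Unique.filter⁺ (λ (x , y) → (x + y) % 2 ≟ 1)
  (Unique.cartesianProduct⁺ (oneTo-unique (2 * m + 1)) (oneTo-unique (2 * n + 1)))
aztec m n .Adj  (x , y) (x′ , y′) = ∣ x - x′ ∣ ≡ 1 × ∣ y - y′ ∣ ≡ 1
aztec m n .adj? (x , y) (x′ , y′) = (∣ x - x′ ∣ ≟ 1) ×-dec (∣ y - y′ ∣ ≟ 1)
aztec m n .adj-sym {x , y} {x′ , y′} (x~ , y~) =
  trans (∣-∣-comm x′ x) x~ , trans (∣-∣-comm y′ y) y~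

Present : ℕ → ℕ → Direction × ℕ × ℕ → Set
Present m n (U , a , b) = 2 ≤ a
Present m n (D , a , b) = suc a ≤ m
Present m n (L , a , b) = 2 ≤ b
Present m n (R , a , b) = suc b ≤ n

present? : ∀ m n → Unary.Decidable (Present m n)
present? m n (U , a , b) = 2 ≤? a
present? m n (D , a , b) = suc a ≤? m
present? m n (L , a , b) = 2 ≤? b
present? m n (R , a , b) = suc b ≤? n

-- Each edge is given in one direction only; Adj below symmetrises it.

Edge : Rel (Direction × ℕ × ℕ) _
Edge (U , s) (L , t) = s ≡ t
Edge (U , s) (R , t) = s ≡ t
Edge (D , s) (L , t) = s ≡ t
Edge (D , s) (R , t) = s ≡ t
Edge (D , a , b) (U , t) = t ≡ (suc a , b)
Edge (R , a , b) (L , t) = t ≡ (a , suc b)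
Edge _       _       = ⊥

edge? : Decidable Edge
edge? (U , s) (U , t) = no λ ()
edge? (U , s) (D , t) = no λ ()
edge? (U , s) (L , t) = ≡-dec _≟_ _≟_ s t
edge? (U , s) (R , t) = ≡-dec _≟_ _≟_ s t
edge? (D , a , b) (U , t) = ≡-dec _≟_ _≟_ t (suc a , b)
edge? (D , s) (D , t) = no λ ()
edge? (D , s) (L , t) = ≡-dec _≟_ _≟_ s t
edge? (D , s) (R , t) = ≡-dec _≟_ _≟_ s t
edge? (L , s) (U , t) = no λ ()
edge? (L , s) (D , t) = no λ ()
edge? (L , s) (L , t) = no λ ()
edge? (L , s) (R , t) = no λ ()
edge? (R , s) (U , t) = no λ ()
edge? (R , s) (D , t) = no λ ()
edge? (R , a , b) (L , t) = ≡-dec _≟_ _≟_ t (a , suc b)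
edge? (R , s) (R , t) = no λ ()

squaresAndOctagons : ℕ → ℕ → Graph (Direction × ℕ × ℕ)
squaresAndOctagons m n .vertices =
  filter (present? m n) (cartesianProduct directions (cartesianProduct (oneTo m) (oneTo n)))
squaresAndOctagons m n .unique = Unique.filter⁺ (present? m n)
  (Unique.cartesianProduct⁺ directions-unique
    (Unique.cartesianProduct⁺ (oneTo-unique m) (oneTo-unique n)))
squaresAndOctagons m n .Adj  u v = Edge u v ⊎ Edge v u
squaresAndOctagons m n .adj? u v = edge? u v ⊎-dec edge? v u
squaresAndOctagons m n .adj-sym  = swap

plane : ∀ Λ → ℕ → ℕ → Graph (Site Λ)
plane quadratic        = grid
plane crossedQuadratic = crossedGrid
plane aztecDiamond     = aztec
plane eightEightFour   = squaresAndOctagons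

merge : ℕ → ℕ → ℕ → ℕ
merge k l j with j ≟ l
... | yes _ = k
... | no  _ = j

-- A vertex is sent to the representative of its class: a vertex of the last
-- column (for glueRows: row) to the corresponding one of the first.

glueColumns : ∀ Λ → ℕ → ℕ → Site Λ → Site Λ
glueColumns quadratic        m n (i , j) = i , merge 0 n j
glueColumns crossedQuadratic m n (i , j) = i , merge 0 n j
glueColumns aztecDiamond     m n (x , y) = x , merge 1 (2 * n + 1) y
glueColumns eightEightFour   m n (U , a , b) = U , a , merge 1 n b
glueColumns eightEightFour   m n (D , a , b) = D , a , merge 1 n b
glueColumns eightEightFour   m n (L , a , b) = L , a , b
glueColumns eightEightFour   m n (R , a , b) = R , a , b

glueRows : ∀ Λ → ℕ → ℕ → Site Λ → Site Λ
glueRows quadratic        m n (i , j) = merge 0 m i , j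
glueRows crossedQuadratic m n (i , j) = merge 0 m i , j
glueRows aztecDiamond     m n (x , y) = merge 1 (2 * m + 1) x , y
glueRows eightEightFour   m n (U , a , b) = U , a , b
glueRows eightEightFour   m n (D , a , b) = D , a , b
glueRows eightEightFour   m n (L , a , b) = L , merge 1 m a , b
glueRows eightEightFour   m n (R , a , b) = R , merge 1 m a , b

-- plane, cylinder and torus at Λ m n are G_{m,n}, H_{n,m} and S_{n,m}.

cylinder : ∀ Λ → ℕ → ℕ → Graph (Site Λ)
cylinder Λ m n = quotient (siteEq? Λ) (glueColumns Λ m n) (plane Λ m n)

torus : ∀ Λ → ℕ → ℕ → Graph (Site Λ)
torus Λ m n = quotient (siteEq? Λ) (glueRows Λ m n) (cylinder Λ m n)

-- The dummy value of root is met only for graphs without vertices, which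
-- occur only for small m or n and so do not affect the limit.

entropyTerm : ∀ {V} → Graph V → ℝ
entropyTerm G = root ∣V G ∣ (i G)

{-# OPTIONS --safe #-}

-- Once m and n are large, each of the three graphs contains q disjoint translates of a
-- k × k block of unit cells, with no edge between two of them, which cover all but a
-- fraction O(1/k) of its vertices.  If the block has c vertices and X independent sets and
-- r of the N vertices are left over, then X ^ q ≤ i(G) ≤ 2 ^ r * X ^ q and X ≤ 2 ^ c, so
-- i(G) ^ (1/N) and X ^ (1/c) differ at most by the factor 2 ^ (r/N).  The block does not
-- see the boundary conditions, so the numbers X ^ (1/c) form a Cauchy sequence, with an
-- explicit modulus, whose limit is the common entropy constant.

module Submission where

open import Defs
open import Data.Bool.Base using (Bool; true; false; not)
open import Data.Empty using (⊥-elim)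
import Data.Integer.Base as ℤ
import Data.Integer.Properties as ℤ
open import Data.List.Base
  using (List; []; _∷_; _++_; map; filter; length; cartesianProduct; upTo)
open import Data.List.Membership.Propositional using (_∈_; find; lose)
open import Data.List.Membership.Propositional.Properties
  using (∈-∃++; ∈-map⁺; ∈-map⁻; ∈-cartesianProduct⁺; ∈-cartesianProduct⁻; ∈-upTo⁻; ∈-upTo⁺;
         ∈-filter⁺; ∈-filter⁻; ∈-deduplicate⁺; ∈-deduplicate⁻)
import Data.List.Properties as List
open import Data.List.Relation.Binary.Permutation.Propositional as ↭ using (_↭_; ↭-trans)
import Data.List.Relation.Binary.Permutation.Propositional.Properties as ↭
open import Data.List.Relation.Binary.Subset.Propositional using (_⊆_)
open import Data.List.Relation.Unary.All as All using (All; []; _∷_)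
import Data.List.Relation.Unary.All.Properties as All
open import Data.List.Relation.Unary.AllPairs using ([]; _∷_)
open import Data.List.Relation.Unary.Any using (here; there)
open import Data.List.Relation.Unary.Unique.Propositional using (Unique)
import Data.List.Relation.Unary.Unique.Propositional.Properties as Unique
open import Data.Nat.Base
open import Data.Nat.DivMod
  using (m≡m%n+[m/n]*n; m%n<n; m/n*n≤m; m*n/n≡m; /-monoˡ-≤; [m+kn]%n≡m%n; m*n%n≡0)
open import Data.Nat.Properties
open import Data.Nat.Tactic.RingSolver using (solve-∀)
open import Data.Product using (_×_; _,_; proj₁; proj₂; ∃-syntax)
open import Data.Rational.Unnormalised.Base as ℚ using (ℚᵘ; 0ℚᵘ)
import Data.Rational.Unnormalised.Properties as ℚ
open import Data.Rational.Unnormalised.Solver using (module +-*-Solver)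
open import Data.Sum as Sum using (_⊎_; inj₁; inj₂)
open import Data.Unit.Base using (⊤; tt)
open import Function.Base using (_∘_; id)
open import Function.Bundles using (_⇔_; mk⇔; module Equivalence)
open import Function.Properties.Equivalence using () renaming (refl to ⇔-refl; trans to ⇔-trans)
open import Relation.Binary.Definitions using (DecidableEquality)
open import Relation.Binary.PropositionalEquality
open import Relation.Nullary using (¬_; yes; no)
open import Relation.Unary using (Decidable)

-- A constructive limit needs an explicit rate, which a monotonicity or subadditivity argument would
-- not supply; comparing every graph with blocks of a fixed size does. Roots are compared through
-- integer powers only: `X ^ N` and `i(G) ^ c` agree up to the factor `2 ^ (c * r)`, whose root of
-- order `c * N` is 2 ^ (r/N). Bernoulli's inequality bounds this by 1 + 1/K as soon as K r ≤ N, so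
-- the geometric task is to make the uncovered fraction r/N at most 1/K. The gaps of width 1 cost a
-- fraction of about 1/s of each side for blocks of side s; the margin at the boundary costs no more
-- once the side is long enough.

open Equivalence using (to; from)

-- Counting subsets

module _ {A : Set} where

  -- The predicate is arbitrary, not just `Independent G`: deciding whether `x` is chosen turns `P`
  -- into `P ∘ (x ∷_)`, so the inductions below have to run over all predicates at once.
  #subsets : {P : List A → Set} → Decidable P → List A → ℕ
  #subsets P? xs = length (filter P? (subsets xs))

  filter-map : ∀ {B : Set} {P : A → Set} (P? : Decidable P) (f : B → A) xs →
               length (filter P? (map f xs)) ≡ length (filter (P? ∘ f) xs)
  filter-map P? f []       = refl
  filter-map P? f (x ∷ xs) with P? (f x)
  ... | yes _ = cong suc (filter-map P? f xs)
  ... | no  _ = filter-map P? f xs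

module _ {A : Set} where

  #subsets-∷ : {P : List A → Set} (P? : Decidable P) → ∀ x xs →
               #subsets P? (x ∷ xs) ≡ #subsets (P? ∘ (x ∷_)) xs + #subsets P? xs
  #subsets-∷ P? x xs = begin
    length (filter P? (map (x ∷_) (subsets xs) ++ subsets xs))
      ≡⟨ cong length (List.filter-++ P? (map (x ∷_) (subsets xs)) (subsets xs)) ⟩
    length (filter P? (map (x ∷_) (subsets xs)) ++ filter P? (subsets xs))
      ≡⟨ List.length-++ (filter P? (map (x ∷_) (subsets xs))) ⟩
    length (filter P? (map (x ∷_) (subsets xs))) + #subsets P? xs
      ≡⟨ cong (_+ #subsets P? xs) (filter-map P? (x ∷_) (subsets xs)) ⟩
    #subsets (P? ∘ (x ∷_)) xs + #subsets P? xs ∎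
    where open ≡-Reasoning

  #subsets-mono : {P Q : List A → Set} (P? : Decidable P) (Q? : Decidable Q) → ∀ xs →
                  (∀ S → All (_∈ xs) S → P S → Q S) → #subsets P? xs ≤ #subsets Q? xs
  #subsets-mono P? Q? [] P⇒Q with P? [] | Q? []
  ... | yes p | yes q = ≤-refl
  ... | yes p | no ¬q = ⊥-elim (¬q (P⇒Q [] [] p))
  ... | no ¬p | _     = z≤n
  #subsets-mono P? Q? (x ∷ xs) P⇒Q = begin
    #subsets P? (x ∷ xs)                        ≡⟨ #subsets-∷ P? x xs ⟩
    #subsets (P? ∘ (x ∷_)) xs + #subsets P? xs
      ≤⟨ +-mono-≤ (#subsets-mono (P? ∘ (x ∷_)) (Q? ∘ (x ∷_)) xs
                    λ S S⊆ → P⇒Q (x ∷ S) (here refl ∷ All.map there S⊆))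
                  (#subsets-mono P? Q? xs λ S S⊆ → P⇒Q S (All.map there S⊆)) ⟩
    #subsets (Q? ∘ (x ∷_)) xs + #subsets Q? xs  ≡⟨ #subsets-∷ Q? x xs ⟨
    #subsets Q? (x ∷ xs)                        ∎
    where open ≤-Reasoning

  #subsets-cong : {P Q : List A → Set} (P? : Decidable P) (Q? : Decidable Q) → ∀ xs →
                  (∀ S → All (_∈ xs) S → P S ⇔ Q S) → #subsets P? xs ≡ #subsets Q? xs
  #subsets-cong P? Q? xs P⇔Q = ≤-antisym
    (#subsets-mono P? Q? xs λ S S⊆ → to (P⇔Q S S⊆))
    (#subsets-mono Q? P? xs λ S S⊆ → from (P⇔Q S S⊆))

#subsets-map : ∀ {A B : Set} {P : List A → Set} (P? : Decidable P) (f : B → A) xs →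
               #subsets P? (map f xs) ≡ #subsets (P? ∘ map f) xs
#subsets-map P? f [] with P? []
... | yes _ = refl
... | no  _ = refl
#subsets-map P? f (x ∷ xs) = begin
  #subsets P? (map f (x ∷ xs))
    ≡⟨ #subsets-∷ P? (f x) (map f xs) ⟩
  #subsets (P? ∘ (f x ∷_)) (map f xs) + #subsets P? (map f xs)
    ≡⟨ cong₂ _+_ (#subsets-map (P? ∘ (f x ∷_)) f xs) (#subsets-map P? f xs) ⟩
  #subsets (P? ∘ map f ∘ (x ∷_)) xs + #subsets (P? ∘ map f) xs
    ≡⟨ #subsets-∷ (P? ∘ map f) x xs ⟨
  #subsets (P? ∘ map f) (x ∷ xs) ∎
  where open ≡-Reasoning

module _ {A : Set} where

  -- `subsets` keeps the order of its list, so permuting the list also permutes the entries of each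
  -- subset; `resp` absorbs this.
  #subsets-↭ : {P : List A → Set} (P? : Decidable P) → (∀ {S T} → S ↭ T → P S → P T) →
               ∀ {xs ys} → xs ↭ ys → #subsets P? xs ≡ #subsets P? ys
  #subsets-↭ P? resp ↭.refl = refl
  #subsets-↭ P? resp (↭.trans p q) = trans (#subsets-↭ P? resp p) (#subsets-↭ P? resp q)
  #subsets-↭ P? resp {x ∷ xs} {x ∷ ys} (↭.prep x p) = begin
    #subsets P? (x ∷ xs)
      ≡⟨ #subsets-∷ P? x xs ⟩
    #subsets (P? ∘ (x ∷_)) xs + #subsets P? xs
      ≡⟨ cong₂ _+_ (#subsets-↭ (P? ∘ (x ∷_)) (λ q → resp (↭.prep x q)) p)
                   (#subsets-↭ P? resp p) ⟩
    #subsets (P? ∘ (x ∷_)) ys + #subsets P? ys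
      ≡⟨ #subsets-∷ P? x ys ⟨
    #subsets P? (x ∷ ys) ∎
    where open ≡-Reasoning
  #subsets-↭ P? resp {x ∷ y ∷ xs} {y ∷ x ∷ ys} (↭.swap x y p) = begin
    #subsets P? (x ∷ y ∷ xs)
      ≡⟨ unfold x y xs ⟩
    (#xs (λ S → P? (x ∷ y ∷ S)) + #xs (λ S → P? (x ∷ S))) + (#xs (λ S → P? (y ∷ S)) + #xs P?)
      ≡⟨ cong₂ _+_
           (cong₂ _+_
             (trans (#subsets-cong _ (λ S → P? (y ∷ x ∷ S)) xs λ S _ →
                      mk⇔ (resp (↭.swap x y ↭.refl)) (resp (↭.swap y x ↭.refl)))
                    (#subsets-↭ (λ S → P? (y ∷ x ∷ S)) (λ q → resp (↭.prep y (↭.prep x q))) p))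
             (#subsets-↭ (λ S → P? (x ∷ S)) (λ q → resp (↭.prep x q)) p))
           (cong₂ _+_
             (#subsets-↭ (λ S → P? (y ∷ S)) (λ q → resp (↭.prep y q)) p)
             (#subsets-↭ P? resp p)) ⟩
    (#ys (λ S → P? (y ∷ x ∷ S)) + #ys (λ S → P? (x ∷ S))) + (#ys (λ S → P? (y ∷ S)) + #ys P?)
      -- Of the four cases for `x` and `y`, the two that choose exactly one of them change places.
      ≡⟨ +-interchange (#ys (λ S → P? (y ∷ x ∷ S))) _ _ _ ⟩
    (#ys (λ S → P? (y ∷ x ∷ S)) + #ys (λ S → P? (y ∷ S))) + (#ys (λ S → P? (x ∷ S)) + #ys P?)
      ≡⟨ unfold y x ys ⟨
    #subsets P? (y ∷ x ∷ ys) ∎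
    where
    open ≡-Reasoning
    open import Algebra.Properties.CommutativeSemigroup +-commutativeSemigroup
      using () renaming (interchange to +-interchange)
    #xs #ys : {Q : List A → Set} → Decidable Q → ℕ
    #xs Q? = #subsets Q? xs
    #ys Q? = #subsets Q? ys
    unfold : ∀ x y zs → #subsets P? (x ∷ y ∷ zs) ≡
             (#subsets (λ S → P? (x ∷ y ∷ S)) zs + #subsets (λ S → P? (x ∷ S)) zs) +
             (#subsets (λ S → P? (y ∷ S)) zs + #subsets P? zs)
    unfold x y zs = trans (#subsets-∷ P? x (y ∷ zs))
      (cong₂ _+_ (#subsets-∷ (P? ∘ (x ∷_)) y zs) (#subsets-∷ P? y zs))

  #subsets-++ : {P Q R : List A → Set}
                (P? : Decidable P) (Q? : Decidable Q) (R? : Decidable R) → ∀ xs ys →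
                (∀ S T → All (_∈ xs) S → All (_∈ ys) T → P (S ++ T) ⇔ (Q S × R T)) →
                #subsets P? (xs ++ ys) ≡ #subsets Q? xs * #subsets R? ys
  #subsets-++ P? Q? R? [] ys P⇔Q×R with Q? []
  ... | yes q = trans
    (#subsets-cong P? R? ys λ T T⊆ → mk⇔ (proj₂ ∘ to (P⇔Q×R [] T [] T⊆))
                                         (λ r → from (P⇔Q×R [] T [] T⊆) (q , r)))
    (sym (+-identityʳ _))
  -- Without `Q []` no `T` satisfies `P`, so the count is at most that of the empty predicate, which
  -- is 0.
  ... | no ¬q = n≤0⇒n≡0 (≤-trans
    (#subsets-mono P? (λ _ → no id) ys λ T T⊆ p → ¬q (proj₁ (to (P⇔Q×R [] T [] T⊆) p)))
    (≤-reflexive (cong length (List.filter-none (λ _ → no id) (All.universal (λ _ ()) (subsets ys))))))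
  #subsets-++ P? Q? R? (x ∷ xs) ys P⇔Q×R = begin
    #subsets P? (x ∷ xs ++ ys)
      ≡⟨ #subsets-∷ P? x (xs ++ ys) ⟩
    #subsets (P? ∘ (x ∷_)) (xs ++ ys) + #subsets P? (xs ++ ys)
      ≡⟨ cong₂ _+_
           (#subsets-++ (P? ∘ (x ∷_)) (Q? ∘ (x ∷_)) R? xs ys λ S T S⊆ →
             P⇔Q×R (x ∷ S) T (here refl ∷ All.map there S⊆))
           (#subsets-++ P? Q? R? xs ys λ S T S⊆ → P⇔Q×R S T (All.map there S⊆)) ⟩
    #subsets (Q? ∘ (x ∷_)) xs * #subsets R? ys + #subsets Q? xs * #subsets R? ys
      ≡⟨ *-distribʳ-+ (#subsets R? ys) (#subsets (Q? ∘ (x ∷_)) xs) (#subsets Q? xs) ⟨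
    (#subsets (Q? ∘ (x ∷_)) xs + #subsets Q? xs) * #subsets R? ys
      ≡⟨ cong (_* #subsets R? ys) (#subsets-∷ Q? x xs) ⟨
    #subsets Q? (x ∷ xs) * #subsets R? ys ∎
    where open ≡-Reasoning

module _ {A : Set} where

  ∈-tail : ∀ {x z : A} {xs} → x ≢ z → z ∈ x ∷ xs → z ∈ xs
  ∈-tail x≢z (here z≡x) = ⊥-elim (x≢z (sym z≡x))
  ∈-tail x≢z (there z∈) = z∈

  -- As `xs` has no repetitions, its later entries survive the removal of `x` from `ys`. In the
  -- tiling, `zs` is the list of leftover vertices and its length is `r`.
  ⊆⇒↭++ : {xs ys : List A} → Unique xs → xs ⊆ ys → ∃[ zs ] (ys ↭ xs ++ zs)
  ⊆⇒↭++ {[]}     {ys} _            _     = ys , ↭.refl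
  ⊆⇒↭++ {x ∷ xs} {ys} (x∉xs ∷ xs!) xs⊆ys
    with as , bs , refl ← ∈-∃++ (xs⊆ys (here refl))
    with zs , p ← ⊆⇒↭++ {xs} {as ++ bs} xs! (λ z∈ →
      ∈-tail (All.lookup x∉xs z∈) (↭.∈-resp-↭ (↭.shift x as bs) (xs⊆ys (there z∈))))
    = zs , ↭-trans (↭.shift x as bs) (↭.prep x p)

  ⊆⇒length≤ : {xs ys : List A} → Unique xs → xs ⊆ ys → length xs ≤ length ys
  ⊆⇒length≤ {xs} xs! xs⊆ys with zs , p ← ⊆⇒↭++ xs! xs⊆ys =
    ≤-trans (List.length-++-≤ˡ xs) (≤-reflexive (sym (↭.↭-length p)))

  length-cartesianProduct : ∀ {B : Set} (xs : List A) (ys : List B) →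
                            length (cartesianProduct xs ys) ≡ length xs * length ys
  length-cartesianProduct []       ys = refl
  length-cartesianProduct (x ∷ xs) ys = begin
    length (map (x ,_) ys ++ cartesianProduct xs ys)
      ≡⟨ List.length-++ (map (x ,_) ys) ⟩
    length (map (x ,_) ys) + length (cartesianProduct xs ys)
      ≡⟨ cong₂ _+_ (List.length-map (x ,_) ys) (length-cartesianProduct xs ys) ⟩
    length ys + length xs * length ys ∎
    where open ≡-Reasoning

-- Independent sets within a list of vertices

module _ {V : Set} (G : Graph V) where

  -- Sets inside `xs` are counted with the adjacency of all of `G`, so no induced subgraphs are
  -- formed; `i G` is `iOn (vertices G)` by definition.
  iOn : List V → ℕ
  iOn xs = #subsets (independent? G) xs

  Independent-tail : ∀ {v S} → Independent G (v ∷ S) → Independent G S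
  Independent-tail (_ ∷ ind) = All.map All.tail ind

  Independent-↭ : ∀ {S T} → S ↭ T → Independent G S → Independent G T
  Independent-↭ p ind = All.map (↭.All-resp-↭ p) (↭.All-resp-↭ p ind)

  iOn-↭ : ∀ {xs ys} → xs ↭ ys → iOn xs ≡ iOn ys
  iOn-↭ = #subsets-↭ (independent? G) Independent-↭

  iOn-∷-lower : ∀ x xs → iOn xs ≤ iOn (x ∷ xs)
  iOn-∷-lower x xs = ≤-trans (m≤n+m _ _) (≤-reflexive (sym (#subsets-∷ (independent? G) x xs)))

  -- Deleting `x` from an independent set leaves an independent set, so those with `x` are no more
  -- than those without.
  iOn-∷-upper : ∀ x xs → iOn (x ∷ xs) ≤ 2 * iOn xs
  iOn-∷-upper x xs = begin
    iOn (x ∷ xs)                                   ≡⟨ #subsets-∷ (independent? G) x xs ⟩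
    #subsets (independent? G ∘ (x ∷_)) xs + iOn xs
      ≤⟨ +-monoˡ-≤ (iOn xs) (#subsets-mono (independent? G ∘ (x ∷_)) (independent? G) xs
                              λ _ _ → Independent-tail) ⟩
    iOn xs + iOn xs                                ≡⟨ cong (iOn xs +_) (+-identityʳ (iOn xs)) ⟨
    2 * iOn xs                                     ∎
    where open ≤-Reasoning

  iOn-++-lower : ∀ zs xs → iOn xs ≤ iOn (zs ++ xs)
  iOn-++-lower []       xs = ≤-refl
  iOn-++-lower (z ∷ zs) xs = ≤-trans (iOn-++-lower zs xs) (iOn-∷-lower z (zs ++ xs))

  iOn-++-upper : ∀ zs xs → iOn (zs ++ xs) ≤ 2 ^ length zs * iOn xs
  iOn-++-upper []       xs = ≤-reflexive (sym (+-identityʳ (iOn xs)))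
  iOn-++-upper (z ∷ zs) xs = begin
    iOn (z ∷ zs ++ xs)               ≤⟨ iOn-∷-upper z (zs ++ xs) ⟩
    2 * iOn (zs ++ xs)               ≤⟨ *-monoʳ-≤ 2 (iOn-++-upper zs xs) ⟩
    2 * (2 ^ length zs * iOn xs)     ≡⟨ *-assoc 2 (2 ^ length zs) (iOn xs) ⟨
    2 ^ length (z ∷ zs) * iOn xs     ∎
    where open ≤-Reasoning

  iOn-positive : ∀ xs → 1 ≤ iOn xs
  iOn-positive xs = subst (λ ys → 1 ≤ iOn ys) (List.++-identityʳ xs) (iOn-++-lower xs [])

  iOn-≤2^ : ∀ xs → iOn xs ≤ 2 ^ length xs
  iOn-≤2^ xs = begin
    iOn xs                ≡⟨ cong iOn (List.++-identityʳ xs) ⟨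
    iOn (xs ++ [])        ≤⟨ iOn-++-upper xs [] ⟩
    2 ^ length xs * 1     ≡⟨ *-identityʳ (2 ^ length xs) ⟩
    2 ^ length xs         ∎
    where open ≤-Reasoning

  iOn-* : ∀ xs ys → (∀ {x y} → x ∈ xs → y ∈ ys → ¬ Adj G x y) →
          iOn (xs ++ ys) ≡ iOn xs * iOn ys
  iOn-* xs ys apart = #subsets-++ (independent? G) (independent? G) (independent? G) xs ys
    λ S T S⊆ T⊆ → mk⇔
      (λ ind → All.map (All.++⁻ˡ S) (All.++⁻ˡ S ind) , All.map (All.++⁻ʳ S) (All.++⁻ʳ S ind))
      (λ (indS , indT) → All.++⁺
        (All.zipWith (λ (p , q) → All.++⁺ p q)
          (indS , All.map (λ x∈ → All.map (apart x∈) T⊆) S⊆))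
        (All.zipWith (λ (p , q) → All.++⁺ p q)
          -- `Independent` tests every pair in both orders, whereas `apart` covers one; symmetry
          -- gives the other.
          (All.map (λ y∈ → All.map (λ x∈ → apart x∈ y∈ ∘ adj-sym G) S⊆) T⊆ , indT)))

iOn-map : ∀ {V W : Set} (G : Graph V) (H : Graph W) (f : V → W) xs →
          (∀ {x y} → x ∈ xs → y ∈ xs → Adj G x y ⇔ Adj H (f x) (f y)) →
          iOn H (map f xs) ≡ iOn G xs
iOn-map G H f xs adj = trans (#subsets-map (independent? H) f xs)
  (#subsets-cong (independent? H ∘ map f) (independent? G) xs λ S S⊆ → mk⇔
    (λ ind → All.zipWith (λ (x∈ , p) → All.zipWith (λ (y∈ , q) → q ∘ to (adj x∈ y∈)) (S⊆ , All.map⁻ p))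
               (S⊆ , All.map⁻ ind))
    (λ ind → All.map⁺ (All.zipWith
       (λ (x∈ , p) → All.map⁺ (All.zipWith (λ (y∈ , q) → q ∘ from (adj x∈ y∈)) (S⊆ , p)))
       (S⊆ , ind))))

-- Powers of natural numbers

^-distribʳ-* : ∀ n a b → (a * b) ^ n ≡ a ^ n * b ^ n
^-distribʳ-* zero    a b = refl
^-distribʳ-* (suc n) a b = trans (cong (a * b *_) (^-distribʳ-* n a b))
                                 ([m*n]*[o*p]≡[m*o]*[n*p] a b (a ^ n) (b ^ n))

^-cancelʳ-≤ : ∀ n .{{_ : NonZero n}} {a b} → a ^ n ≤ b ^ n → a ≤ b
^-cancelʳ-≤ n a^n≤b^n = ≮⇒≥ λ b<a → <⇒≱ (^-monoˡ-< n b<a) a^n≤b^n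

-- This is 1 + n/k ≤ (1 + 1/k)^n with denominators cleared.
bernoulli : ∀ k n → (k + n) * k ^ n ≤ k * suc k ^ n
bernoulli k zero    = ≤-reflexive (cong (_* 1) (+-identityʳ k))
bernoulli k (suc n) = begin
  (k + suc n) * (k * k ^ n)          ≤⟨ m≤m+n _ (n * k ^ n) ⟩
  (k + suc n) * (k * k ^ n) + n * k ^ n  ≡⟨ rearrange k n (k ^ n) ⟩
  suc k * ((k + n) * k ^ n)          ≤⟨ *-monoʳ-≤ (suc k) (bernoulli k n) ⟩
  suc k * (k * suc k ^ n)            ≡⟨ swap-* (suc k) k (suc k ^ n) ⟩
  k * (suc k * suc k ^ n)            ∎
  where
  open ≤-Reasoning
  rearrange : ∀ k n p → (k + suc n) * (k * p) + n * p ≡ suc k * ((k + n) * p)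
  rearrange = solve-∀
  swap-* : ∀ a b c → a * (b * c) ≡ b * (a * c)
  swap-* = solve-∀

2*k^k≤[1+k]^k : ∀ k → .{{NonZero k}} → 2 * k ^ k ≤ suc k ^ k
2*k^k≤[1+k]^k k = *-cancelˡ-≤ k (≤-trans (≤-reflexive (double k (k ^ k))) (bernoulli k k))
  where
  double : ∀ k p → k * (2 * p) ≡ (k + k) * p
  double = solve-∀

-- From 2 ≤ (1 + 1/k)^k follows 2^d ≤ (1 + 1/k)^(d k), and further factors 1 + 1/k only help: in
-- effect 2^(d/n) ≤ 1 + 1/k.
2^d*k^n≤[1+k]^n : ∀ k d n → .{{NonZero k}} → d * k ≤ n → 2 ^ d * k ^ n ≤ suc k ^ n
2^d*k^n≤[1+k]^n k d n dk≤n = begin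
  2 ^ d * k ^ n                     ≡⟨ cong (λ e → 2 ^ d * k ^ e) (m+[n∸m]≡n dk≤n) ⟨
  2 ^ d * k ^ (d * k + e)           ≡⟨ cong (2 ^ d *_) (^-distribˡ-+-* k (d * k) e) ⟩
  2 ^ d * (k ^ (d * k) * k ^ e)     ≡⟨ *-assoc (2 ^ d) (k ^ (d * k)) (k ^ e) ⟨
  2 ^ d * k ^ (d * k) * k ^ e       ≡⟨ cong (λ p → 2 ^ d * p * k ^ e) (^-flip k) ⟨
  2 ^ d * (k ^ k) ^ d * k ^ e       ≡⟨ cong (_* k ^ e) (^-distribʳ-* d 2 (k ^ k)) ⟨
  (2 * k ^ k) ^ d * k ^ e           ≤⟨ *-mono-≤ (^-monoˡ-≤ d (2*k^k≤[1+k]^k k))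
                                                (^-monoˡ-≤ e (n≤1+n k)) ⟩
  (suc k ^ k) ^ d * suc k ^ e       ≡⟨ cong (_* suc k ^ e) (^-flip (suc k)) ⟩
  suc k ^ (d * k) * suc k ^ e       ≡⟨ ^-distribˡ-+-* (suc k) (d * k) e ⟨
  suc k ^ (d * k + e)               ≡⟨ cong (suc k ^_) (m+[n∸m]≡n dk≤n) ⟩
  suc k ^ n                         ∎
  where
  open ≤-Reasoning
  e = n ∸ d * k
  ^-flip : ∀ a → (a ^ k) ^ d ≡ a ^ (d * k)
  ^-flip a = trans (^-*-assoc a k d) (cong (a ^_) (*-comm k d))

-- Fractions

e : ℕ → ℚᵘ
e n = ℤ.+ 1 ℚ./ suc n

n/d≤n/d+n/d : ∀ a s b t c u → a * (suc t * suc u) ≤ (b * suc u + c * suc t) * suc s →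
              ℤ.+ a ℚ./ suc s ℚ.≤ (ℤ.+ b ℚ./ suc t) ℚ.+ (ℤ.+ c ℚ./ suc u)
n/d≤n/d+n/d a s b t c u le = ℚ.*≤*
  (subst₂ ℤ._≤_ (ℤ.pos-* a (suc t * suc u))
    (trans (ℤ.pos-* (b * suc u + c * suc t) (suc s))
      (cong (ℤ._* ℤ.+ suc s) (trans (ℤ.pos-+ (b * suc u) (c * suc t))
        (cong₂ ℤ._+_ (ℤ.pos-* b (suc u)) (ℤ.pos-* c (suc t))))))
    (ℤ.+≤+ le))

e+e≤2/n : ∀ n → e n ℚ.+ e n ℚ.≤ ℤ.+ 2 ℚ./ suc n
e+e≤2/n n = ℚ.*≤* (ℤ.≤-reflexive (cong ℤ.+_ (lemma n)))
  where
  lemma : ∀ n → (1 * suc n + 1 * suc n) * suc n ≡ 2 * (suc n * suc n)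
  lemma = solve-∀

-- The index at which `_-ℝ_` reads its arguments; the error at `half n` is half the error at `n`.
half : ℕ → ℕ
half n = suc (2 * n)

e-half : ∀ n → e (half n) ℚ.+ e (half n) ℚ.≃ e n
e-half n = ℚ.*≡* (cong ℤ.+_ (lemma n))
  where
  lemma : ∀ n → (1 * suc (suc (2 * n)) + 1 * suc (suc (2 * n))) * suc n ≡
                1 * (suc (suc (2 * n)) * suc (suc (2 * n)))
  lemma = solve-∀

e-small : ∀ {ε} → 0ℚᵘ ℚ.< ε → ∃[ k ] e k ℚ.+ e k ℚ.≤ ε
e-small {ℚ.mkℚᵘ (ℤ.+ zero) d} (ℚ.*<* (ℤ.+<+ ()))
-- A positive `ε` with denominator `d + 1` is at least 1/(d + 1).
e-small {ℚ.mkℚᵘ (ℤ.+ suc p) d} _ = half d , ℚ.≤-trans (ℚ.≤-reflexive (e-half d))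
  (ℚ.*≤* (ℤ.+≤+ (*-monoˡ-≤ (suc d) (s≤s (z≤n {p})))))
e-small {ℚ.mkℚᵘ ℤ.-[1+ p ] d} (ℚ.*<* ())

-- This is stronger than x ≤ y + δ: the terms of x get no error margin, as those of a root
-- only err downwards.

infix 4 _≤[_]_

record _≤[_]_ (x : ℝ) (δ : ℚᵘ) (y : ℝ) : Set where
  constructor within
  field
    approx-≤ : ∀ s t → approx x s ℚ.≤ approx y t ℚ.+ (e t ℚ.+ δ)

open _≤[_]_

-- Comparison of roots

-- A root of Y ≤ 2 ^ b is at most 2, so multiplying it by 1 + 1/K, where 2 ^ (d / (a b)) ≤ 1 + 1/K,
-- adds at most 3/K, rounding included.

root-≤ : ∀ k {a b X Y d} → 1 ≤ a → 1 ≤ b → X ^ b ≤ Y ^ a * 2 ^ d → Y ≤ 2 ^ b →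
         d * (3 * suc k) ≤ a * b → root a X ≤[ e k ] root b Y
root-≤ k {a@(suc a′)} {b@(suc b′)} {X} {Y} {d} _ _ X≤Y Y≤2^b dK≤ .approx-≤ s t = ℚ.≤-trans
  -- Rounding forces the detour over (y + 1)/T: the fraction y/T bounds the root of `Y` from below,
  -- (y + 1)/T bounds it from above.
  (n/d≤n/d+n/d x s (suc y) t 1 k main)
  (ℚ.≤-trans (ℚ.+-monoˡ-≤ (e k) (n/d≤n/d+n/d (suc y) t y t 1 t (≤-reflexive (split y t))))
             (ℚ.≤-reflexive (ℚ.+-assoc (ℤ.+ y ℚ./ suc t) (e t) (e k))))
  where
  open ≤-Reasoning
  K = 3 * suc k
  S = suc s
  T = suc t
  n = b * a
  x = floorRoot a (X * S ^ a)
  y = floorRoot b (Y * T ^ b)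

  split : ∀ y t → suc y * (suc t * suc t) ≡ (y * suc t + 1 * suc t) * suc t
  split = solve-∀

  y≤2T : y ≤ 2 * T
  y≤2T = ^-cancelʳ-≤ b (begin
    y ^ b            ≤⟨ floorRoot-lower b′ (Y * T ^ b) ⟩
    Y * T ^ b        ≤⟨ *-monoˡ-≤ (T ^ b) Y≤2^b ⟩
    2 ^ b * T ^ b    ≡⟨ ^-distribʳ-* b 2 T ⟨
    (2 * T) ^ b      ∎)

  -- Turns the relative error 1/K into the absolute error 3/K = 1/(k + 1).
  1+y≤3T : suc y ≤ 3 * T
  1+y≤3T = +-mono-≤ (s≤s (z≤n {t})) y≤2T

  dK≤n : d * K ≤ n
  dK≤n = ≤-trans dK≤ (≤-reflexive (*-comm a b))

  x^n : x ^ n ≤ X ^ b * S ^ n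
  x^n = begin
    x ^ n                ≡⟨ flip x ⟨
    (x ^ a) ^ b          ≤⟨ ^-monoˡ-≤ b (floorRoot-lower a′ (X * S ^ a)) ⟩
    (X * S ^ a) ^ b      ≡⟨ ^-distribʳ-* b X (S ^ a) ⟩
    X ^ b * (S ^ a) ^ b  ≡⟨ cong (X ^ b *_) (flip S) ⟩
    X ^ b * S ^ n        ∎
    where
    flip : ∀ z → (z ^ a) ^ b ≡ z ^ n
    flip z = trans (^-*-assoc z a b) (cong (z ^_) (*-comm a b))

  y^n : Y ^ a * T ^ n ≤ suc y ^ n
  y^n = begin
    Y ^ a * T ^ n        ≡⟨ cong (Y ^ a *_) (^-*-assoc T b a) ⟨
    Y ^ a * (T ^ b) ^ a  ≡⟨ ^-distribʳ-* a Y (T ^ b) ⟨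
    (Y * T ^ b) ^ a      ≤⟨ ^-monoˡ-≤ a (<⇒≤ (floorRoot-upper b′ (Y * T ^ b))) ⟩
    (suc y ^ b) ^ a      ≡⟨ ^-*-assoc (suc y) b a ⟩
    suc y ^ n            ∎

  -- Raising to the power `n = b * a` removes both roots at once; the factor `2 ^ d` is paid for by
  -- the ratio (K + 1)/K.
  cross : x * (K * T) ≤ suc y * (suc K * S)
  cross = ^-cancelʳ-≤ n {{m*n≢0 b a}} (begin
    (x * (K * T)) ^ n
      ≡⟨ distrib₃ x K T ⟩
    x ^ n * (K ^ n * T ^ n)
      ≤⟨ *-monoˡ-≤ (K ^ n * T ^ n) (≤-trans x^n (*-monoˡ-≤ (S ^ n) X≤Y)) ⟩
    Y ^ a * 2 ^ d * S ^ n * (K ^ n * T ^ n)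
      ≡⟨ rearrange (Y ^ a) (2 ^ d) (S ^ n) (K ^ n) (T ^ n) ⟩
    Y ^ a * T ^ n * ((2 ^ d * K ^ n) * S ^ n)
      ≤⟨ *-mono-≤ y^n (*-monoˡ-≤ (S ^ n) (2^d*k^n≤[1+k]^n K d n dK≤n)) ⟩
    suc y ^ n * (suc K ^ n * S ^ n)
      ≡⟨ distrib₃ (suc y) (suc K) S ⟨
    (suc y * (suc K * S)) ^ n ∎)
    where
    distrib₃ : ∀ u v w → (u * (v * w)) ^ n ≡ u ^ n * (v ^ n * w ^ n)
    distrib₃ u v w = trans (^-distribʳ-* n u (v * w)) (cong (u ^ n *_) (^-distribʳ-* n v w))
    rearrange : ∀ p q r u v → p * q * r * (u * v) ≡ p * v * ((q * u) * r)
    rearrange = solve-∀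

  main : x * (T * suc k) ≤ (suc y * suc k + 1 * T) * S
  main = *-cancelˡ-≤ 3 (begin
    3 * (x * (T * suc k))                    ≡⟨ lhs x T (suc k) ⟩
    x * (K * T)                              ≤⟨ cross ⟩
    suc y * (suc K * S)                      ≡⟨ mid (suc y) K S ⟩
    suc y * K * S + suc y * S                ≤⟨ +-monoʳ-≤ (suc y * K * S) (*-monoˡ-≤ S 1+y≤3T) ⟩
    suc y * K * S + 3 * T * S                ≡⟨ rhs (suc y) (suc k) T S ⟩
    3 * ((suc y * suc k + 1 * T) * S)        ∎)
    where
    lhs : ∀ x t k → 3 * (x * (t * k)) ≡ x * (3 * k * t)
    lhs = solve-∀
    mid : ∀ y k s → y * (suc k * s) ≡ y * k * s + y * s
    mid = solve-∀
    rhs : ∀ y k t s → y * (3 * k) * s + 3 * t * s ≡ 3 * ((y * k + 1 * t) * s)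
    rhs = solve-∀

-- Limits of double sequences

infix 4 _~_

-- The index of `x` is a precision: the single number `x k` is within 1/(k + 1) of all sufficiently
-- late `f m n`. Being tied to `x` and not to a limit, the relation can be proved before the limit
-- exists.
_~_ : (ℕ → ℕ → ℝ) → (ℕ → ℝ) → Set
f ~ x = ∀ k → ∃[ N ] (∀ m n → N ≤ m → N ≤ n → (f m n ≤[ e k ] x k) × (x k ≤[ e k ] f m n))

-- The middle real is seen only through its term at `t`, which costs `e t`; each use picks `t` as
-- large as its estimate requires.
≤[]-trans : ∀ {x y z γ δ} t → x ≤[ γ ] y → y ≤[ δ ] z → x ≤[ (e t ℚ.+ γ) ℚ.+ δ ] z
≤[]-trans {x} {y} {z} {γ} {δ} t x≤y y≤z .approx-≤ r s = ℚ.≤-trans (approx-≤ x≤y r t)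
  (ℚ.≤-trans (ℚ.+-monoˡ-≤ (e t ℚ.+ γ) (approx-≤ y≤z t s))
    (ℚ.≤-reflexive (solve 5 (λ z s d t g → (z :+ (s :+ d)) :+ (t :+ g) := z :+ (s :+ ((t :+ g) :+ d)))
      ℚ.≃-refl (approx z s) (e s) δ (e t) γ)))
  where open +-*-Solver

private
  p≤q+r⇒p-q≤r : ∀ p q r → p ℚ.≤ q ℚ.+ r → p ℚ.- q ℚ.≤ r
  p≤q+r⇒p-q≤r p q r p≤q+r = ℚ.≤-respʳ-≃
    (solve 2 (λ q r → (q :+ r) :- q := r) ℚ.≃-refl q r)
    (ℚ.+-monoˡ-≤ (ℚ.- q) p≤q+r)
    where open +-*-Solver

  ∣p-q∣≤r : ∀ p q r → p ℚ.≤ q ℚ.+ r → q ℚ.≤ p ℚ.+ r → ℚ.∣ p ℚ.- q ∣ ℚ.≤ r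
  ∣p-q∣≤r p q r p≤ q≤ with ℚ.∣p∣≡p∨∣p∣≡-p (p ℚ.- q)
  ... | inj₁ eq = subst (ℚ._≤ r) (sym eq) (p≤q+r⇒p-q≤r p q r p≤)
  ... | inj₂ eq = subst (ℚ._≤ r) (sym eq)
    (ℚ.≤-respˡ-≃ (solve 2 (λ p q → q :- p := :- (p :- q)) ℚ.≃-refl p q)
      (p≤q+r⇒p-q≤r q p r q≤))
    where open +-*-Solver

module Limit (x : ℕ → ℝ) (g : ℕ → ℕ → ℝ) (g~x : g ~ x) where

  -- Both are compared with one value of `g`, taken late enough for `k` and for `l`. In the
  -- application this is the entropy term of a large graph, which is tiled by blocks of either size.
  x≤x : ∀ k l t → x k ≤[ (e t ℚ.+ e k) ℚ.+ e l ] x l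
  x≤x k l t with M , M≤ ← g~x k | N , N≤ ← g~x l = ≤[]-trans t
    (proj₂ (M≤ (M ⊔ N) (M ⊔ N) (m≤m⊔n M N) (m≤m⊔n M N)))
    (proj₁ (N≤ (M ⊔ N) (M ⊔ N) (m≤n⊔m M N) (m≤n⊔m M N)))

  -- A diagonal: comparing the terms at `m` and `n` costs 2 e (half m) + 2 e (half n), exactly the e
  -- m + e n that regularity allows.
  limit : ℝ
  limit .approx  n   = approx (x (half n)) (half n)
  limit .regular m n = ∣p-q∣≤r _ _ _ (bound m n)
    (ℚ.≤-trans (bound n m) (ℚ.+-monoʳ-≤ (approx (x (half m)) (half m))
      (ℚ.≤-reflexive (ℚ.+-comm (e n) (e m)))))
    where
    bound : ∀ m n → approx (x (half m)) (half m) ℚ.≤ approx (x (half n)) (half n) ℚ.+ (e m ℚ.+ e n)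
    bound m n = ℚ.≤-trans (approx-≤ (x≤x (half m) (half n) (half m)) (half m) (half n))
      (ℚ.+-monoʳ-≤ (approx (x (half n)) (half n))
        (ℚ.≤-reflexive (ℚ.≃-trans
          (solve 2 (λ a b → b :+ ((a :+ a) :+ b) := (a :+ a) :+ (b :+ b)) ℚ.≃-refl
            (e (half m)) (e (half n)))
          (ℚ.+-cong (e-half m) (e-half n)))))
      where open +-*-Solver

  ~⇒⟶ : ∀ {f} → f ~ x → f ⟶ limit
  ~⇒⟶ {f} f~x ε ε>0 with k , k≤ε ← e-small ε>0 with N , N≤ ← f~x k =
    N , λ m n N≤m N≤n j →
      let f≤x , x≤f = N≤ m n N≤m N≤n
          -- `_-ℝ_` reads `f m n` and `limit` at `half j`, and the latter reads `x` at
          -- `half (half j)`. The errors then add up to 2/(k + 1), covered by `ε`, and at most the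
          -- 2/(j + 1) that `_≤ℝ_` grants.
          s = half j
      in ∣p-q∣≤r (approx (f m n) s) (approx limit s) _
           (ℚ.≤-trans (approx-≤ (≤[]-trans s f≤x (x≤x k (half s) s)) s (half s))
             (ℚ.+-monoʳ-≤ (approx limit s) (ℚ.≤-trans
               (ℚ.≤-reflexive (upper (e s) (e (half s)) (e k))) (error k j k≤ε))))
           (ℚ.≤-trans (approx-≤ (≤[]-trans s (x≤x (half s) k (half s)) x≤f) (half s) s)
             (ℚ.+-monoʳ-≤ (approx (f m n) s) (ℚ.≤-trans
               (ℚ.≤-reflexive (lower (e s) (e (half s)) (e k))) (error k j k≤ε))))
    where
    open +-*-Solver
    upper : ∀ s h k → h ℚ.+ ((s ℚ.+ k) ℚ.+ ((s ℚ.+ k) ℚ.+ h)) ℚ.≃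
                      (k ℚ.+ k) ℚ.+ ((s ℚ.+ s) ℚ.+ (h ℚ.+ h))
    upper = solve 3 (λ s h k → h :+ ((s :+ k) :+ ((s :+ k) :+ h)) :=
                               (k :+ k) :+ ((s :+ s) :+ (h :+ h))) ℚ.≃-refl
    lower : ∀ s h k → s ℚ.+ ((s ℚ.+ ((h ℚ.+ h) ℚ.+ k)) ℚ.+ k) ℚ.≃
                      (k ℚ.+ k) ℚ.+ ((s ℚ.+ s) ℚ.+ (h ℚ.+ h))
    lower = solve 3 (λ s h k → s :+ ((s :+ ((h :+ h) :+ k)) :+ k) :=
                               (k :+ k) :+ ((s :+ s) :+ (h :+ h))) ℚ.≃-refl
    error : ∀ k j → e k ℚ.+ e k ℚ.≤ ε →
            (e k ℚ.+ e k) ℚ.+ ((e (half j) ℚ.+ e (half j)) ℚ.+ (e (half (half j)) ℚ.+ e (half (half j))))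
            ℚ.≤ ε ℚ.+ (ℤ.+ 2 ℚ./ suc j)
    error k j k≤ε = ℚ.+-mono-≤ k≤ε (begin
      (e (half j) ℚ.+ e (half j)) ℚ.+ (e (half (half j)) ℚ.+ e (half (half j)))
        ≃⟨ ℚ.+-cong (e-half j) (e-half (half j)) ⟩
      e j ℚ.+ e (half j)                    ≤⟨ ℚ.+-monoʳ-≤ (e j) (ℚ.p≤p+q (e (half j)) (e (half j))) ⟩
      e j ℚ.+ (e (half j) ℚ.+ e (half j))   ≃⟨ ℚ.+-congʳ (e j) (e-half j) ⟩
      e j ℚ.+ e j                           ≤⟨ e+e≤2/n j ⟩
      ℤ.+ 2 ℚ./ suc j                       ∎)
      where open ℚ.≤-Reasoning

-- Separated blocks in a rectangle

unique-map⁺ : ∀ {A B : Set} (f : A → B) {xs} →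
              (∀ {x y} → x ∈ xs → y ∈ xs → f x ≡ f y → x ≡ y) → Unique xs → Unique (map f xs)
unique-map⁺ f inj []          = []
unique-map⁺ f inj (x∉xs ∷ xs!) =
  All.map⁺ (All.tabulate λ y∈ fx≡fy → All.lookup x∉xs y∈ (inj (here refl) (there y∈) fx≡fy))
  ∷ unique-map⁺ f (λ x∈ y∈ → inj (there x∈) (there y∈)) xs!

Near : ℕ → ℕ → Set
Near x y = ∣ x - y ∣ ≤ 1

near⁻ : ∀ x y → Near x y → x ≤ suc y
near⁻ x y x~y = begin
  x                ≤⟨ m≤n+∣m-n∣ x y ⟩
  y + ∣ x - y ∣    ≤⟨ +-monoʳ-≤ y x~y ⟩
  y + 1            ≡⟨ +-comm y 1 ⟩
  suc y            ∎
  where open ≤-Reasoning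

near-sym : ∀ x y → Near x y → Near y x
near-sym x y = subst (_≤ 1) (∣-∣-comm x y)

near-refl : ∀ x → Near x x
near-refl x = ≤-trans (≤-reflexive (∣n-n∣≡0 x)) z≤n

near-reflexive : ∀ {x y} → x ≡ y → Near x y
near-reflexive {x} refl = near-refl x

near-suc : ∀ x → Near x (suc x)
near-suc zero    = ≤-refl
near-suc (suc x) = near-suc x

-- The blocks have width k but period k + 1: the gap keeps different blocks non-adjacent.

module _ {k : ℕ} where

  separated-≤ : ∀ {a b p q} → b < k → a + p * suc k ≤ suc (b + q * suc k) → p ≤ q
  separated-≤ {a} {b} {p} {q} b<k near = ≮⇒≥ λ q<p → <⇒≱ (s≤s b<k) (+-cancelʳ-≤ (q * suc k) _ _ (begin
    suc k + q * suc k        ≤⟨ *-monoˡ-≤ (suc k) q<p ⟩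
    p * suc k                ≤⟨ m≤n+m (p * suc k) a ⟩
    a + p * suc k            ≤⟨ near ⟩
    suc b + q * suc k        ∎))
    where open ≤-Reasoning

  -- Distance 0 is included, so the same lemma makes different translates disjoint and keeps edges
  -- from joining them.
  separated : ∀ {a b p q} → a < k → b < k → Near (a + p * suc k) (b + q * suc k) → p ≡ q
  separated {a} {b} {p} {q} a<k b<k near = ≤-antisym
    (separated-≤ b<k (near⁻ x y near))
    (separated-≤ a<k (near⁻ y x (near-sym x y near)))
    where
    x = a + p * suc k
    y = b + q * suc k

-- The number of blocks along a side of length m; subtracting 2 keeps them away from the
-- glued boundary.

fit : ℕ → ℕ → ℕ
fit k m = (m ∸ 2) / suc k

m≤[1+m/n]*n : ∀ m n .{{_ : NonZero n}} → m ≤ suc (m / n) * n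
m≤[1+m/n]*n m n = begin
  m                      ≡⟨ m≡m%n+[m/n]*n m n ⟩
  m % n + m / n * n      ≤⟨ +-monoˡ-≤ (m / n * n) (<⇒≤ (m%n<n m n)) ⟩
  n + m / n * n          ∎
  where open ≤-Reasoning

fit-inside : ∀ k m {a p} → a < k → p < fit k m → 3 + (a + p * suc k) ≤ m
fit-inside k m {a} {p} a<k p<fit = begin
  -- Two of the three units are those subtracted in `fit`; the third comes from `a < k`.
  3 + (a + p * suc k)       ≤⟨ s≤s (s≤s (+-monoˡ-≤ (p * suc k) (m≤n⇒m≤1+n a<k))) ⟩
  2 + (suc p * suc k)       ≤⟨ +-monoʳ-≤ 2 below ⟩
  -- A whole period fits into `m ∸ 2`, so the subtraction was not truncated.
  2 + (m ∸ 2)               ≡⟨ m+[n∸m]≡n {2} (<⇒≤ (m∸n≢0⇒n<m {m} {2} λ m∸2≡0 →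
                                  m<n⇒n≢0 (≤-trans (s≤s z≤n) below) m∸2≡0)) ⟩
  m                         ∎
  where
  open ≤-Reasoning
  below : suc p * suc k ≤ m ∸ 2
  below = ≤-trans (*-monoˡ-≤ (suc k) p<fit) (m/n*n≤m (m ∸ 2) (suc k))

-- Makes room for `2 * j + 4` blocks along a side, so that the gaps, one per block, are at least as
-- many as the cells lost at the ends.
threshold : ℕ → ℕ
threshold j = 2 + (2 * j + 4) * suc (2 * j)

fit-many : ∀ j m → threshold j ≤ m → 2 * j + 4 ≤ fit (2 * j) m
fit-many j m large = begin
  2 * j + 4                                  ≡⟨ m*n/n≡m (2 * j + 4) (suc (2 * j)) ⟨
  (2 * j + 4) * suc (2 * j) / suc (2 * j)    ≤⟨ /-monoˡ-≤ (suc (2 * j)) (∸-monoˡ-≤ 2 large) ⟩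
  fit (2 * j) m                              ∎
  where open ≤-Reasoning

-- With `q` blocks of side `2 * j`, the gaps take `q` cells and the ends at most `2 * j + 4`, hence
-- at most `q`. The loss of at most 2 q is a fraction 1/j of the `q * (2 * j)` cells covered.
fit-fills : ∀ j m → threshold j ≤ m → suc m * j ≤ suc j * (fit (2 * j) m * (2 * j))
fit-fills j m large = begin
  suc m * j                               ≤⟨ *-monoˡ-≤ j (s≤s (m≤n+m∸n m 2)) ⟩
  (3 + (m ∸ 2)) * j                       ≤⟨ *-monoˡ-≤ j (+-monoʳ-≤ 3 (m≤[1+m/n]*n (m ∸ 2) (suc (2 * j)))) ⟩
  (3 + suc q * suc (2 * j)) * j           ≡⟨ lhs q j ⟩
  (2 * j + 4 + q) * j + q * (2 * j) * j   ≤⟨ +-monoˡ-≤ (q * (2 * j) * j) (*-monoˡ-≤ j (+-monoˡ-≤ q (fit-many j m large))) ⟩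
  (q + q) * j + q * (2 * j) * j           ≡⟨ rhs q j ⟩
  suc j * (q * (2 * j))                   ∎
  where
  open ≤-Reasoning
  q = fit (2 * j) m
  lhs : ∀ q j → (3 + suc q * suc (2 * j)) * j ≡ (2 * j + 4 + q) * j + q * (2 * j) * j
  lhs = solve-∀
  rhs : ∀ q j → (q + q) * j + q * (2 * j) * j ≡ suc j * (q * (2 * j))
  rhs = solve-∀

-- (1 + 1/j)² ≤ 1 + 1/l for j = 2l + 1: the losses along the two sides combine.

product-fills : ∀ l u v p q → let j = suc (2 * l) in
                u * j ≤ suc j * p → v * j ≤ suc j * q → l * (u * v) ≤ suc l * (p * q)
product-fills l u v p q u≤p v≤q = *-cancelˡ-≤ (j * j) (begin
  j * j * (l * (u * v))             ≡⟨ lhs j l u v ⟩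
  l * ((u * j) * (v * j))           ≤⟨ *-monoʳ-≤ l (*-mono-≤ u≤p v≤q) ⟩
  l * ((suc j * p) * (suc j * q))   ≡⟨ mid l (suc j) p q ⟩
  l * (suc j * suc j) * (p * q)     ≤⟨ *-monoˡ-≤ (p * q) (≤-trans (m≤m+n _ (suc l)) (≤-reflexive (factor l))) ⟩
  j * j * suc l * (p * q)           ≡⟨ *-assoc (j * j) (suc l) (p * q) ⟩
  j * j * (suc l * (p * q))         ∎)
  where
  open ≤-Reasoning
  j = suc (2 * l)
  lhs : ∀ j l u v → j * j * (l * (u * v)) ≡ l * ((u * j) * (v * j))
  lhs = solve-∀
  mid : ∀ l s p q → l * ((s * p) * (s * q)) ≡ l * (s * s) * (p * q)
  mid = solve-∀
  factor : ∀ l → l * (suc (suc (2 * l)) * suc (suc (2 * l))) + suc l ≡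
                 suc (2 * l) * suc (2 * l) * suc l
  factor = solve-∀

-- The sites other than those near the boundary, indexed by unit cells.

record Periodic (Λ : Lattice) : Set₁ where
  field
    Kind         : Set
    kinds        : List Kind
    kinds-unique : Unique kinds
    kinds-exist  : 1 ≤ length kinds

  Cell : Set
  Cell = Kind × ℕ × ℕ

  field
    site           : Cell → Site Λ
    site-injective : ∀ {x y} → site x ≡ site y → x ≡ y

  -- `Adj (plane Λ m n)` does not involve `m` and `n`, so size 0 stands for all sizes; the sites
  -- need not be vertices of that graph.
  _—_ : Cell → Cell → Set
  x — y = Adj (plane Λ 0 0) (site x) (site y)

  -- One margin for all four lattices. The 8.8.4 lattice, with sites starting at square 2, uses all
  -- of it: `D` at square `2 + a` is present only if `3 + a ≤ m`.
  Inside : ℕ → ℕ → Cell → Set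
  Inside m n (κ , a , b) = 3 + a ≤ m × 3 + b ≤ n

  field
    local     : ∀ {κ a b κ′ a′ b′} → (κ , a , b) — (κ′ , a′ , b′) → Near a a′ × Near b b′
    translate : ∀ {κ a b κ′ a′ b′} s t → (κ , a , b) — (κ′ , a′ , b′) ⇔
                                         (κ , a + s , b + t) — (κ′ , a′ + s , b′ + t)

  -- All that the counting uses of a graph. Plane, cylinder and torus satisfy it alike, since it
  -- fixes the graph on inner cells and beyond that only bounds the number of vertices.
  record Window (m n : ℕ) (G : Graph (Site Λ)) : Set where
    field
      inside-∈   : ∀ {x} → Inside m n x → site x ∈ vertices G
      inside-Adj : ∀ {x y} → Inside m n x → Inside m n y → x — y ⇔ Adj G (site x) (site y)
      size       : ∣V G ∣ ≤ length kinds * (suc m * suc n)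

  square : ℕ → List (ℕ × ℕ)
  square k = cartesianProduct (upTo k) (upTo k)

  block : ℕ → Graph Cell
  block k .vertices = cartesianProduct kinds (square k)
  block k .unique   = Unique.cartesianProduct⁺ kinds-unique
                        (Unique.cartesianProduct⁺ (Unique.upTo⁺ k) (Unique.upTo⁺ k))
  block k .Adj  x y = x — y
  block k .adj? x y = adj? (plane Λ 0 0) (site x) (site y)
  block k .adj-sym  = adj-sym (plane Λ 0 0)

  ∣block∣ : ∀ k → ∣V block k ∣ ≡ length kinds * (k * k)
  ∣block∣ k = trans (length-cartesianProduct kinds (square k)) (cong (length kinds *_)
    (trans (length-cartesianProduct (upTo k) (upTo k)) (cong₂ _*_ (List.length-upTo k) (List.length-upTo k))))

  module Tiling (k m n : ℕ) where

    tiles : List (ℕ × ℕ)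
    tiles = cartesianProduct (upTo (fit k m)) (upTo (fit k n))

    place : ℕ × ℕ → Cell → Cell
    place (p , q) (κ , a , b) = κ , a + p * suc k , b + q * suc k

    ∈block⁻ : ∀ {κ a b} → (κ , a , b) ∈ vertices (block k) → a < k × b < k
    ∈block⁻ x∈ with a∈ , b∈ ← ∈-cartesianProduct⁻ (upTo k) (upTo k)
                                (proj₂ (∈-cartesianProduct⁻ kinds (square k) x∈))
      = ∈-upTo⁻ a∈ , ∈-upTo⁻ b∈

    place-inside : ∀ {t x} → t ∈ tiles → x ∈ vertices (block k) → Inside m n (place t x)
    place-inside {p , q} {κ , a , b} t∈ x∈
      with p∈ , q∈ ← ∈-cartesianProduct⁻ (upTo (fit k m)) (upTo (fit k n)) t∈
      with a<k , b<k ← ∈block⁻ x∈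
      = fit-inside k m a<k (∈-upTo⁻ p∈) , fit-inside k n b<k (∈-upTo⁻ q∈)

    place-separated : ∀ {s t x y} → x ∈ vertices (block k) → y ∈ vertices (block k) →
                      place s x — place t y → s ≡ t
    place-separated x∈ y∈ x—y with near₁ , near₂ ← local x—y
                              with a<k , b<k ← ∈block⁻ x∈ | a′<k , b′<k ← ∈block⁻ y∈
      = cong₂ _,_ (separated a<k a′<k near₁) (separated b<k b′<k near₂)

    -- Equal cells are in particular near, so `separated` identifies the tiles first; then the
    -- offsets can be cancelled.
    place-injective : ∀ {s t x y} → x ∈ vertices (block k) → y ∈ vertices (block k) →
                      place s x ≡ place t y → (s , x) ≡ (t , y)
    place-injective {p , q} {p′ , q′} {κ , a , b} {κ′ , a′ , b′} x∈ y∈ eq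
      with a<k , b<k ← ∈block⁻ x∈ | a′<k , b′<k ← ∈block⁻ y∈
      with refl ← separated {p = p} {p′} a<k a′<k (near-reflexive (cong (proj₁ ∘ proj₂) eq))
      with refl ← separated {p = q} {q′} b<k b′<k (near-reflexive (cong (proj₂ ∘ proj₂) eq))
      = cong ((p , q) ,_) (cong₂ _,_ (cong proj₁ eq) (cong₂ _,_
          (+-cancelʳ-≡ (p * suc k) a a′ (cong (proj₁ ∘ proj₂) eq))
          (+-cancelʳ-≡ (q * suc k) b b′ (cong (proj₂ ∘ proj₂) eq))))

    at : (ℕ × ℕ) × Cell → Site Λ
    at (t , x) = site (place t x)

    tiled : List (ℕ × ℕ) → List (Site Λ)
    tiled ts = map at (cartesianProduct ts (vertices (block k)))

    ∣tiled∣ : ∀ ts → length (tiled ts) ≡ length ts * ∣V block k ∣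
    ∣tiled∣ ts = trans (List.length-map at (cartesianProduct ts (vertices (block k))))
                        (length-cartesianProduct ts (vertices (block k)))

    tiled-unique : Unique (tiled tiles)
    tiled-unique = unique-map⁺ at
      (λ {x} {y} x∈ y∈ eq → place-injective {s = proj₁ x} {proj₁ y}
        (proj₂ (∈-cartesianProduct⁻ tiles (vertices (block k)) x∈))
        (proj₂ (∈-cartesianProduct⁻ tiles (vertices (block k)) y∈))
        (site-injective eq))
      (Unique.cartesianProduct⁺
        (Unique.cartesianProduct⁺ (Unique.upTo⁺ (fit k m)) (Unique.upTo⁺ (fit k n)))
        (unique (block k)))

    module _ {G : Graph (Site Λ)} (window : Window m n G) where
      open Window window

      tiled-⊆ : tiled tiles ⊆ vertices G
      tiled-⊆ v∈ with (t , x) , tx∈ , refl ← ∈-map⁻ at v∈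
                 with t∈ , x∈ ← ∈-cartesianProduct⁻ tiles (vertices (block k)) tx∈
        = inside-∈ (place-inside t∈ x∈)

      iOn-tile : ∀ {t} → t ∈ tiles → iOn G (map (at ∘ (t ,_)) (vertices (block k))) ≡ i (block k)
      iOn-tile {p , q} t∈ = iOn-map (block k) G (at ∘ ((p , q) ,_)) (vertices (block k)) λ x∈ y∈ → mk⇔
        (to (inside-Adj (place-inside t∈ x∈) (place-inside t∈ y∈)) ∘ to (translate (p * suc k) (q * suc k)))
        (from (translate (p * suc k) (q * suc k)) ∘ from (inside-Adj (place-inside t∈ x∈) (place-inside t∈ y∈)))

      -- The induction runs over lists of distinct tiles: distinctness keeps the first tile apart
      -- from the others, and `iOn-*` splits off its factor.
      iOn-tiled : ∀ ts → Unique ts → All (_∈ tiles) ts → iOn G (tiled ts) ≡ i (block k) ^ length ts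
      iOn-tiled []       _           _         = refl
      iOn-tiled (t ∷ ts) (t∉ts ∷ ts!) (t∈ ∷ ts⊆) = begin
        iOn G (map at (map (t ,_) xs ++ cartesianProduct ts xs))
          ≡⟨ cong (iOn G) (List.map-++ at (map (t ,_) xs) (cartesianProduct ts xs)) ⟩
        iOn G (map at (map (t ,_) xs) ++ tiled ts)
          ≡⟨ cong (λ ys → iOn G (ys ++ tiled ts)) (List.map-∘ xs) ⟨
        iOn G (map (at ∘ (t ,_)) xs ++ tiled ts)
          ≡⟨ iOn-* G (map (at ∘ (t ,_)) xs) (tiled ts) apart ⟩
        iOn G (map (at ∘ (t ,_)) xs) * iOn G (tiled ts)
          ≡⟨ cong₂ _*_ (iOn-tile t∈) (iOn-tiled ts ts! ts⊆) ⟩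
        i (block k) * i (block k) ^ length ts ∎
        where
        open ≡-Reasoning
        xs = vertices (block k)
        apart : ∀ {u v} → u ∈ map (at ∘ (t ,_)) xs → v ∈ tiled ts → ¬ Adj G u v
        apart u∈ v∈ u~v
          with x , x∈ , refl ← ∈-map⁻ (at ∘ (t ,_)) u∈
          with (s , y) , sy∈ , refl ← ∈-map⁻ at v∈
          with s∈ , y∈ ← ∈-cartesianProduct⁻ ts xs sy∈
          = All.lookup t∉ts s∈ (place-separated {t} {s} x∈ y∈
              (from (inside-Adj (place-inside t∈ x∈) (place-inside (All.lookup ts⊆ s∈) y∈)) u~v))

-- Graphs whose vertices are q copies of a set of c vertices, and r others

module _ (q c r : ℕ) {N X Y : ℕ} (N≡ : N ≡ r + q * c) (1≤X : 1 ≤ X) (X≤2^c : X ≤ 2 ^ c)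
         (X^q≤Y : X ^ q ≤ Y) (Y≤2^r*X^q : Y ≤ 2 ^ r * X ^ q) where

  private
    open ≤-Reasoning

    X^N : X ^ N ≡ X ^ r * (X ^ q) ^ c
    X^N = trans (cong (X ^_) N≡) (trans (^-distribˡ-+-* X r (q * c))
      (cong (X ^ r *_) (sym (^-*-assoc X q c))))

  -- Of the `N` factors `X`, the `r` that belong to no tile are bounded by `2 ^ c` each; hence the
  -- exponent `c * r`.
  tiled-lower : X ^ N ≤ Y ^ c * 2 ^ (c * r)
  tiled-lower = begin
    X ^ N                     ≡⟨ X^N ⟩
    X ^ r * (X ^ q) ^ c       ≤⟨ *-mono-≤ (^-monoˡ-≤ r X≤2^c) (^-monoˡ-≤ c X^q≤Y) ⟩
    (2 ^ c) ^ r * Y ^ c       ≡⟨ cong (_* Y ^ c) (^-*-assoc 2 c r) ⟩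
    2 ^ (c * r) * Y ^ c       ≡⟨ *-comm (2 ^ (c * r)) (Y ^ c) ⟩
    Y ^ c * 2 ^ (c * r)       ∎

  -- Here the extra factor comes from `Y` itself, as `2 ^ r` to the power `c`; the missing `X ^ r`
  -- is at least 1 and can be inserted.
  tiled-upper : Y ^ c ≤ X ^ N * 2 ^ (c * r)
  tiled-upper = begin
    Y ^ c                           ≤⟨ ^-monoˡ-≤ c Y≤2^r*X^q ⟩
    (2 ^ r * X ^ q) ^ c             ≡⟨ ^-distribʳ-* c (2 ^ r) (X ^ q) ⟩
    (2 ^ r) ^ c * (X ^ q) ^ c       ≤⟨ *-monoʳ-≤ ((2 ^ r) ^ c) (m≤n*m ((X ^ q) ^ c) (X ^ r)
                                        {{m^n≢0 X r {{>-nonZero 1≤X}}}}) ⟩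
    (2 ^ r) ^ c * (X ^ r * (X ^ q) ^ c)  ≡⟨ cong₂ _*_ (^-*-assoc 2 r c) (sym X^N) ⟩
    2 ^ (r * c) * X ^ N             ≡⟨ cong (λ d → 2 ^ d * X ^ N) (*-comm r c) ⟩
    2 ^ (c * r) * X ^ N             ≡⟨ *-comm (2 ^ (c * r)) (X ^ N) ⟩
    X ^ N * 2 ^ (c * r)             ∎

-- Entropy terms approximated by block terms

module Approximation {Λ : Lattice} (periodic : Periodic Λ) where
  open Periodic periodic

  -- With K = 3 (k + 1), the number demanded by `root-≤`, this is the 2 K + 1 for which
  -- `product-fills` turns a loss of 1/(2 K + 1) along each side into 1/K of the area. Blocks have
  -- twice this side because gaps and ends each take half of that loss.
  scale : ℕ → ℕ
  scale k = suc (2 * (3 * suc k))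

  blockTerm : ℕ → ℝ
  blockTerm k = entropyTerm (block (2 * scale k))

  ~-blockTerm : (F : ℕ → ℕ → Graph (Site Λ)) → (∀ m n → Window m n (F m n)) →
                (λ m n → entropyTerm (F m n)) ~ blockTerm
  ~-blockTerm F windows k = threshold (scale k) , λ m n M≤m M≤n → approximate m n M≤m M≤n
    where
    approximate : ∀ m n → threshold (scale k) ≤ m → threshold (scale k) ≤ n →
                  (entropyTerm (F m n) ≤[ e k ] blockTerm k) × (blockTerm k ≤[ e k ] entropyTerm (F m n))
    approximate m n M≤m M≤n with zs , p ← ⊆⇒↭++ (Tiling.tiled-unique (2 * scale k) m n)
                                              (Tiling.tiled-⊆ (2 * scale k) m n (windows m n))
      -- Both directions use `d = c * r`, for which d/(c N) = r/N is at most 1/K.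
      = root-≤ k {d = c * r} 1≤N 1≤c (tiled-upper q c r N≡ 1≤X X≤2^c X^q≤Y Y≤2^r*X^q) X≤2^c
               (≤-trans d≤ (≤-reflexive (*-comm c N)))
      , root-≤ k {d = c * r} 1≤c 1≤N (tiled-lower q c r N≡ 1≤X X≤2^c X^q≤Y Y≤2^r*X^q) Y≤2^N d≤
      where
      open ≤-Reasoning
      s = 2 * scale k
      K = 3 * suc k
      open Tiling s m n
      G = F m n
      open Window (windows m n)
      c = ∣V block s ∣
      N = ∣V G ∣
      X = i (block s)
      Y = i G
      q = length tiles
      r = length zs
      xs = tiled tiles

      p′ : vertices G ↭ zs ++ xs
      p′ = ↭-trans p (↭.++-comm xs zs)

      N≡ : N ≡ r + q * c
      N≡ = trans (↭.↭-length p′) (trans (List.length-++ zs) (cong (r +_) (∣tiled∣ tiles)))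

      1≤X : 1 ≤ X
      1≤X = iOn-positive (block s) (vertices (block s))
      X≤2^c : X ≤ 2 ^ c
      X≤2^c = iOn-≤2^ (block s) (vertices (block s))
      Y≤2^N : Y ≤ 2 ^ N
      Y≤2^N = iOn-≤2^ G (vertices G)

      tiles≡ : iOn G xs ≡ X ^ q
      tiles≡ = iOn-tiled (windows m n) tiles
        (Unique.cartesianProduct⁺ (Unique.upTo⁺ (fit s m)) (Unique.upTo⁺ (fit s n)))
        (All.tabulate id)

      X^q≤Y : X ^ q ≤ Y
      X^q≤Y = subst₂ _≤_ tiles≡ (sym (iOn-↭ G p′)) (iOn-++-lower G zs xs)

      Y≤2^r*X^q : Y ≤ 2 ^ r * X ^ q
      Y≤2^r*X^q = subst₂ _≤_ (sym (iOn-↭ G p′)) (cong (2 ^ r *_) tiles≡) (iOn-++-upper G zs xs)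

      1≤c : 1 ≤ c
      1≤c = subst (1 ≤_) (sym (∣block∣ s)) (*-mono-≤ kinds-exist (*-mono-≤ {1} {s} {1} {s} (s≤s z≤n) (s≤s z≤n)))

      q≡ : q ≡ fit s m * fit s n
      q≡ = trans (length-cartesianProduct (upTo (fit s m)) (upTo (fit s n)))
                 (cong₂ _*_ (List.length-upTo (fit s m)) (List.length-upTo (fit s n)))

      K*N≤ : K * N ≤ suc K * (q * c)
      K*N≤ = begin
        K * N
          ≤⟨ *-monoʳ-≤ K size ⟩
        K * (τ * (suc m * suc n))
          ≡⟨ swap-* K τ (suc m * suc n) ⟩
        τ * (K * (suc m * suc n))
          ≤⟨ *-monoʳ-≤ τ (product-fills K (suc m) (suc n) (fit s m * s) (fit s n * s)
                            (fit-fills (scale k) m M≤m) (fit-fills (scale k) n M≤n)) ⟩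
        τ * (suc K * ((fit s m * s) * (fit s n * s)))
          ≡⟨ regroup τ (suc K) (fit s m) (fit s n) s ⟩
        suc K * ((fit s m * fit s n) * (τ * (s * s)))
          ≡⟨ cong (suc K *_) (cong₂ _*_ q≡ (∣block∣ s)) ⟨
        suc K * (q * c) ∎
        where
        τ = length kinds
        swap-* : ∀ a b c → a * (b * c) ≡ b * (a * c)
        swap-* = solve-∀
        regroup : ∀ t l p q s → t * (l * ((p * s) * (q * s))) ≡ l * ((p * q) * (t * (s * s)))
        regroup = solve-∀

      K*r≤q*c : K * r ≤ q * c
      K*r≤q*c = +-cancelʳ-≤ (K * (q * c)) _ _ (begin
        K * r + K * (q * c)      ≡⟨ *-distribˡ-+ K r (q * c) ⟨
        K * (r + q * c)          ≡⟨ cong (K *_) N≡ ⟨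
        K * N                    ≤⟨ K*N≤ ⟩
        q * c + K * (q * c)      ∎)

      q*c≤N : q * c ≤ N
      q*c≤N = ≤-trans (m≤n+m (q * c) r) (≤-reflexive (sym N≡))

      1≤N : 1 ≤ N
      1≤N = ≤-trans (*-mono-≤ 1≤q 1≤c) q*c≤N
        where
        1≤fit : ∀ m → threshold (scale k) ≤ m → 1 ≤ fit s m
        1≤fit m M≤m = ≤-trans (s≤s z≤n) (fit-many (scale k) m M≤m)
        1≤q : 1 ≤ q
        1≤q = subst (1 ≤_) (sym q≡) (*-mono-≤ (1≤fit m M≤m) (1≤fit n M≤n))

      d≤ : c * r * K ≤ c * N
      d≤ = begin
        c * r * K      ≡⟨ *-assoc c r K ⟩
        c * (r * K)    ≡⟨ cong (c *_) (*-comm r K) ⟩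
        c * (K * r)    ≤⟨ *-monoʳ-≤ c (≤-trans K*r≤q*c q*c≤N) ⟩
        c * N          ∎

-- Quotients that leave the interior unchanged

OnlyPreimage : {V W : Set} → (V → W) → V → W → Set
OnlyPreimage f v w = f v ≡ w × (∀ u → f u ≡ w → u ≡ v)

module _ {V W : Set} (_≟′_ : DecidableEquality W) (f : V → W) (G : Graph V) where

  quotient-size : ∣V quotient _≟′_ f G ∣ ≤ ∣V G ∣
  quotient-size = ≤-trans
    (⊆⇒length≤ (unique (quotient _≟′_ f G)) (∈-deduplicate⁻ _≟′_ (map f (vertices G))))
    (≤-reflexive (List.length-map f (vertices G)))

  quotient-∈ : ∀ {v} → v ∈ vertices G → f v ∈ vertices (quotient _≟′_ f G)
  quotient-∈ v∈ = ∈-deduplicate⁺ _≟′_ (∈-map⁺ f v∈)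

  -- An edge of the quotient may come from any members of the two classes; classes with a single
  -- member leave only the given pair.
  quotient-Adj : ∀ {u v x y} → u ∈ vertices G → v ∈ vertices G →
                 OnlyPreimage f u x → OnlyPreimage f v y → Adj G u v ⇔ Adj (quotient _≟′_ f G) x y
  quotient-Adj {u} {v} {x} {y} u∈ v∈ (fu≡x , onlyu) (fv≡y , onlyv) = mk⇔
    (λ u~v → lose u∈ (lose v∈ (fu≡x , fv≡y , u~v))) back
    where
    back : Adj (quotient _≟′_ f G) x y → Adj G u v
    back x~y with u′ , u′∈ , p ← find x~y
             with v′ , v′∈ , fu′≡x , fv′≡y , u′~v′ ← find p
      = subst₂ (Adj G) (onlyu u′ fu′≡x) (onlyv v′ fv′≡y) u′~v′

module _ {k l : ℕ} where

  merge-away : ∀ {j} → j ≢ l → merge k l j ≡ j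
  merge-away {j} j≢l with j ≟ l
  ... | yes j≡l = ⊥-elim (j≢l j≡l)
  ... | no  _   = refl

  merge-only : ∀ j {b} → b ≢ k → merge k l j ≡ b → j ≡ b
  merge-only j b≢k eq with j ≟ l
  ... | yes _ = ⊥-elim (b≢k (sym eq))
  ... | no  _ = eq

record Wrapping {Λ : Lattice} (periodic : Periodic Λ) : Set where
  open Periodic periodic
  field
    plane-Adj   : ∀ {m n x y} → x — y ⇔ Adj (plane Λ m n) (site x) (site y)
    plane-∈     : ∀ {m n} x → Inside m n x → site x ∈ vertices (plane Λ m n)
    plane-size  : ∀ m n → ∣V plane Λ m n ∣ ≤ length kinds * (suc m * suc n)
    columns     : ∀ {m n} x → Inside m n x → OnlyPreimage (glueColumns Λ m n) (site x) (site x)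
    rows        : ∀ {m n} x → Inside m n x → OnlyPreimage (glueRows Λ m n) (site x) (site x)

  -- Gluing keeps the inner cells and cannot raise the number of vertices, so it can be repeated:
  -- one quotient gives the cylinder, a second the torus.
  quotient-window : ∀ {m n G} (f : Site Λ → Site Λ) →
                    (∀ x → Inside m n x → OnlyPreimage f (site x) (site x)) →
                    Window m n G → Window m n (quotient (siteEq? Λ) f G)
  quotient-window {G = G} f only window = record
    { inside-∈   = λ {x} x-in → subst (_∈ vertices (quotient (siteEq? Λ) f G))
        (proj₁ (only x x-in)) (quotient-∈ (siteEq? Λ) f G (inside-∈ x-in))
    ; inside-Adj = λ {x} {y} x-in y-in → ⇔-trans (inside-Adj x-in y-in)
        (quotient-Adj (siteEq? Λ) f G (inside-∈ x-in) (inside-∈ y-in) (only x x-in) (only y y-in))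
    ; size       = ≤-trans (quotient-size (siteEq? Λ) f G) size
    }
    where open Window window

  plane-window : ∀ m n → Window m n (plane Λ m n)
  plane-window m n = record
    { inside-∈   = λ {x} → plane-∈ x
    ; inside-Adj = λ {x} {y} _ _ → plane-Adj {m} {n} {x} {y}
    ; size       = plane-size m n
    }

  cylinder-window : ∀ m n → Window m n (cylinder Λ m n)
  cylinder-window m n = quotient-window (glueColumns Λ m n) columns (plane-window m n)

  torus-window : ∀ m n → Window m n (torus Λ m n)
  torus-window m n = quotient-window (glueRows Λ m n) rows (cylinder-window m n)

  open Approximation periodic

  entropies-agree :
    ∃[ η ] ( (λ m n → entropyTerm (plane    Λ m n)) ⟶ η
           × (λ m n → entropyTerm (cylinder Λ m n)) ⟶ η
           × (λ m n → entropyTerm (torus    Λ m n)) ⟶ η )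
  entropies-agree = limit , ~⇒⟶ plane~ , ~⇒⟶ (~-blockTerm (cylinder Λ) cylinder-window)
                                        , ~⇒⟶ (~-blockTerm (torus Λ) torus-window)
    where
    plane~ : (λ m n → entropyTerm (plane Λ m n)) ~ blockTerm
    plane~ = ~-blockTerm (plane Λ) plane-window
    -- The terms of `limit` come from `blockTerm` alone, and the plane terms only act as the bridge
    -- `g`; hence all three families share this limit.
    open Limit blockTerm (λ m n → entropyTerm (plane Λ m n)) plane~

-- The quadratic lattices

∣-∣-shift : ∀ a a′ s → ∣ a + s - a′ + s ∣ ≡ ∣ a - a′ ∣
∣-∣-shift a a′ s = trans (cong₂ ∣_-_∣ (+-comm a s) (+-comm a′ s)) (∣m+n-m+o∣≡∣n-o∣ s a a′)

⇔-reflexive : {A B : Set} → A ≡ B → A ⇔ B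
⇔-reflexive refl = ⇔-refl

oneKind : List ⊤
oneKind = tt ∷ []

gridSite : ⊤ × ℕ × ℕ → ℕ × ℕ
gridSite (_ , a , b) = suc a , suc b

gridSite-injective : ∀ {x y} → gridSite x ≡ gridSite y → x ≡ y
gridSite-injective refl = refl

grid-∈ : ∀ {m n} x → 3 + proj₁ (proj₂ x) ≤ m × 3 + proj₂ (proj₂ x) ≤ n →
         gridSite x ∈ cartesianProduct (upTo (suc m)) (upTo (suc n))
grid-∈ (_ , a , b) (a≤ , b≤) = ∈-cartesianProduct⁺
  (∈-upTo⁺ (s≤s (≤-trans (n≤1+n _) (≤-trans (n≤1+n _) a≤))))
  (∈-upTo⁺ (s≤s (≤-trans (n≤1+n _) (≤-trans (n≤1+n _) b≤))))

grid-size : ∀ m n → length (cartesianProduct (upTo (suc m)) (upTo (suc n))) ≤ 1 * (suc m * suc n)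
grid-size m n = ≤-reflexive (trans (length-cartesianProduct (upTo (suc m)) (upTo (suc n)))
  (trans (cong₂ _*_ (List.length-upTo (suc m)) (List.length-upTo (suc n))) (sym (+-identityʳ _))))

merge-OnlyPreimage : ∀ {k l j} → j ≢ k → j ≢ l → OnlyPreimage (merge k l) j j
merge-OnlyPreimage j≢k j≢l = merge-away j≢l , λ u → merge-only u j≢k

OnlyPreimage-×ˡ : ∀ {A B : Set} {f : A → A} {a} {b : B} → OnlyPreimage f a a →
                  OnlyPreimage (λ (x , y) → f x , y) (a , b) (a , b)
OnlyPreimage-×ˡ (fa≡a , only) =
  cong (_, _) fa≡a , λ (x , y) eq → cong₂ _,_ (only x (cong proj₁ eq)) (cong proj₂ eq)

OnlyPreimage-×ʳ : ∀ {A B : Set} {f : B → B} {a : A} {b} → OnlyPreimage f b b →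
                  OnlyPreimage (λ (x , y) → x , f y) (a , b) (a , b)
OnlyPreimage-×ʳ (fb≡b , only) =
  cong (_ ,_) fb≡b , λ (x , y) eq → cong₂ _,_ (cong proj₁ eq) (only y (cong proj₂ eq))

inner : ∀ {l a} → 3 + a ≤ l → OnlyPreimage (merge 0 l) (suc a) (suc a)
inner a≤ = merge-OnlyPreimage (λ ()) (<⇒≢ (≤-trans (n≤1+n _) a≤))

quadraticPeriodic : Periodic quadratic
quadraticPeriodic = record
  { kinds          = oneKind
  ; kinds-unique   = [] ∷ []
  ; kinds-exist    = ≤-refl
  ; site           = gridSite
  ; site-injective = gridSite-injective
  ; local          = λ eq → m+n≤o⇒m≤o _ (≤-reflexive eq) , m+n≤o⇒n≤o _ (≤-reflexive eq)
  ; translate      = λ {_} {a} {b} {_} {a′} {b′} s t → ⇔-reflexive (cong (_≡ 1)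
      (sym (cong₂ _+_ (∣-∣-shift a a′ s) (∣-∣-shift b b′ t))))
  }

quadraticWrapping : Wrapping quadraticPeriodic
quadraticWrapping = record
  { plane-Adj  = ⇔-refl
  ; plane-∈    = grid-∈
  ; plane-size = grid-size
  ; columns    = λ (_ , a , b) (_ , b≤) → OnlyPreimage-×ʳ (inner b≤)
  ; rows       = λ (_ , a , b) (a≤ , _) → OnlyPreimage-×ˡ (inner a≤)
  }

crossedPeriodic : Periodic crossedQuadratic
crossedPeriodic = record
  { kinds          = oneKind
  ; kinds-unique   = [] ∷ []
  ; kinds-exist    = ≤-refl
  ; site           = gridSite
  ; site-injective = gridSite-injective
  ; local          = λ (_ , near) → near
  ; translate      = λ {_} {a} {b} {_} {a′} {b′} s t → mk⇔
      (λ (≢ , a~ , b~) → (λ eq → ≢ (cong₂ _,_ (+-cancelʳ-≡ s _ _ (cong proj₁ eq))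
                                               (+-cancelʳ-≡ t _ _ (cong proj₂ eq))))
        , subst (_≤ 1) (sym (∣-∣-shift a a′ s)) a~ , subst (_≤ 1) (sym (∣-∣-shift b b′ t)) b~)
      (λ (≢ , a~ , b~) → (λ eq → ≢ (cong₂ _,_ (cong (_+ s) (cong proj₁ eq))
                                               (cong (_+ t) (cong proj₂ eq))))
        , subst (_≤ 1) (∣-∣-shift a a′ s) a~ , subst (_≤ 1) (∣-∣-shift b b′ t) b~)
  }

crossedWrapping : Wrapping crossedPeriodic
crossedWrapping = record
  { plane-Adj  = ⇔-refl
  ; plane-∈    = grid-∈
  ; plane-size = grid-size
  ; columns    = λ (_ , a , b) (_ , b≤) → OnlyPreimage-×ʳ (inner b≤)
  ; rows       = λ (_ , a , b) (a≤ , _) → OnlyPreimage-×ˡ (inner a≤)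
  }

-- The aztec diamond

∈-oneTo⁺ : ∀ {n j} → 1 ≤ j → j ≤ n → j ∈ oneTo n
∈-oneTo⁺ {j = suc j} _ j<n = ∈-map⁺ suc (∈-upTo⁺ j<n)

∈-oneTo⁻ : ∀ n {j} → j ∈ oneTo n → 1 ≤ j × j ≤ n
∈-oneTo⁻ n j∈ with j′ , j′∈ , refl ← ∈-map⁻ suc j∈ = s≤s z≤n , ∈-upTo⁻ j′∈

length-oneTo : ∀ n → length (oneTo n) ≡ n
length-oneTo n = trans (List.length-map suc (upTo n)) (List.length-upTo n)


bit : Bool → ℕ
bit false = 0
bit true  = 1

-- The coordinates 2 a and 2 a + 1 share the cell index `a`; the bit tells the kinds apart.
digits : Bool → ℕ → ℕ
digits κ a = bit κ + 2 * a

digits-injective : ∀ κ a κ′ a′ → digits κ a ≡ digits κ′ a′ → κ ≡ κ′ × a ≡ a′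
digits-injective false a false a′ eq = refl , *-cancelˡ-≡ a a′ 2 eq
digits-injective false a true  a′ eq = ⊥-elim (even≢odd a a′ eq)
digits-injective true  a false a′ eq = ⊥-elim (even≢odd a′ a (sym eq))
digits-injective true  a true  a′ eq = refl , *-cancelˡ-≡ a a′ 2 (suc-injective eq)

digits-surjective : ∀ n → ∃[ κ ] ∃[ a ] n ≡ digits κ a
digits-surjective zero    = false , 0 , refl
digits-surjective (suc n) with digits-surjective n
... | false , a , refl = true , a , refl
... | true  , a , refl = false , suc a , sym (*-suc 2 a)

digits-≤⁻ : ∀ κ {a m} → digits κ a ≤ suc (2 * m) → a ≤ m
digits-≤⁻ κ {a} {m} le = ≮⇒≥ λ m<a → <⇒≱ (≤-trans (≤-reflexive (sym (*-suc 2 m))) (*-monoʳ-≤ 2 m<a))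
                                          (≤-trans (m≤n+m (2 * a) (bit κ)) le)

bit≤1 : ∀ κ → bit κ ≤ 1
bit≤1 false = z≤n
bit≤1 true  = ≤-refl

digits-< : ∀ κ {a m} → a < m → digits κ a < 2 * m
digits-< κ {a} {m} a<m = begin-strict
  bit κ + 2 * a    ≤⟨ +-monoˡ-≤ (2 * a) (bit≤1 κ) ⟩
  1 + 2 * a        <⟨ ≤-refl ⟩
  2 + 2 * a        ≡⟨ *-suc 2 a ⟨
  2 * suc a        ≤⟨ *-monoʳ-≤ 2 a<m ⟩
  2 * m            ∎
  where open ≤-Reasoning

digits-+ : ∀ κ a s → digits κ (suc (a + s)) ≡ digits κ (suc a) + 2 * s
digits-+ κ a s = lemma (bit κ) a s
  where
  lemma : ∀ c a s → c + 2 * suc (a + s) ≡ c + 2 * suc a + 2 * s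
  lemma = solve-∀

near⁺ : ∀ {x y} → x ≤ suc y → y ≤ suc x → Near x y
near⁺ {zero}  {y}     _  y≤ = y≤
near⁺ {suc x} {zero}  x≤ _  = x≤
near⁺ {suc x} {suc y} x≤ y≤ = near⁺ (s≤s⁻¹ x≤) (s≤s⁻¹ y≤)

digits-local : ∀ κ a κ′ a′ → ∣ digits κ (suc a) - digits κ′ (suc a′) ∣ ≡ 1 → Near a a′
digits-local κ a κ′ a′ eq = near⁺ (halve κ κ′ (near⁻ x y x~y)) (halve κ′ κ (near⁻ y x (near-sym x y x~y)))
  where
  x = digits κ (suc a)
  y = digits κ′ (suc a′)
  x~y = ≤-reflexive eq
  halve : ∀ κ κ′ {a a′} → digits κ (suc a) ≤ suc (digits κ′ (suc a′)) → a ≤ suc a′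
  halve κ κ′ {a} {a′} le = s≤s⁻¹ (digits-≤⁻ κ (≤-trans le
    (s≤s (≤-trans (+-monoˡ-≤ (2 * suc a′) (m≤n⇒m≤1+n (bit≤1 κ′))) (≤-reflexive (sym (*-suc 2 (suc a′))))))))

-- A vertex has one even and one odd coordinate.

aztecVertex : Bool × ℕ × ℕ → ℕ × ℕ
aztecVertex (κ , a , b) = digits κ a , digits (not κ) b

aztecSite : Bool × ℕ × ℕ → ℕ × ℕ
aztecSite (κ , a , b) = aztecVertex (κ , suc a , suc b)

parities : List Bool
parities = false ∷ true ∷ []

parities-complete : ∀ κ → κ ∈ parities
parities-complete false = here refl
parities-complete true  = there (here refl)

aztecVertex-odd : ∀ κ a b → (digits κ a + digits (not κ) b) % 2 ≡ 1
aztecVertex-odd false a b = trans (cong (_% 2) (lemma a b)) ([m+kn]%n≡m%n 1 (a + b) 2)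
  where
  lemma : ∀ a b → 2 * a + (1 + 2 * b) ≡ 1 + (a + b) * 2
  lemma = solve-∀
aztecVertex-odd true a b = trans (cong (_% 2) (lemma a b)) ([m+kn]%n≡m%n 1 (a + b) 2)
  where
  lemma : ∀ a b → 1 + 2 * a + 2 * b ≡ 1 + (a + b) * 2
  lemma = solve-∀

same-parity-even : ∀ κ a b → (digits κ a + digits κ b) % 2 ≡ 0
same-parity-even κ a b = trans (cong (_% 2) (lemma (bit κ) a b)) (m*n%n≡0 (bit κ + a + b) 2)
  where
  lemma : ∀ c a b → c + 2 * a + (c + 2 * b) ≡ (c + a + b) * 2
  lemma = solve-∀

odd⇒aztecVertex : ∀ κ a κ′ b → (digits κ a + digits κ′ b) % 2 ≡ 1 → κ′ ≡ not κ
odd⇒aztecVertex false a true  b _   = refl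
odd⇒aztecVertex true  a false b _   = refl
odd⇒aztecVertex false a false b odd with () ← trans (sym odd) (same-parity-even false a b)
odd⇒aztecVertex true  a true  b odd with () ← trans (sym odd) (same-parity-even true a b)

-- Halving puts the coordinates in 0..m and 0..n, and an odd sum leaves only one of the two last
-- bits free: two kinds for each of (m + 1)(n + 1) cells.
aztec-size : ∀ m n → ∣V aztec m n ∣ ≤ 2 * (suc m * suc n)
aztec-size m n = ≤-trans (⊆⇒length≤ (unique (aztec m n)) covered)
  (≤-reflexive (trans (List.length-map aztecVertex (cartesianProduct parities pairs))
    (trans (length-cartesianProduct parities pairs)
    (cong (2 *_) (trans (length-cartesianProduct (upTo (suc m)) (upTo (suc n)))
      (cong₂ _*_ (List.length-upTo (suc m)) (List.length-upTo (suc n))))))))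
  where
  pairs = cartesianProduct (upTo (suc m)) (upTo (suc n))
  covered : ∀ {v} → v ∈ vertices (aztec m n) → v ∈ map aztecVertex (cartesianProduct parities pairs)
  covered {x , y} v∈
    with xy∈ , odd ← ∈-filter⁻ (λ (x , y) → (x + y) % 2 ≟ 1) v∈
    with x∈ , y∈ ← ∈-cartesianProduct⁻ (oneTo (2 * m + 1)) (oneTo (2 * n + 1)) xy∈
    with κ , a , refl ← digits-surjective x | κ′ , b , refl ← digits-surjective y
    with refl ← odd⇒aztecVertex κ a κ′ b odd
    = ∈-map⁺ aztecVertex (∈-cartesianProduct⁺ (parities-complete κ) (∈-cartesianProduct⁺
        (∈-upTo⁺ (s≤s (bound κ a m x∈))) (∈-upTo⁺ (s≤s (bound (not κ) b n y∈)))))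
    where
    bound : ∀ κ a m → digits κ a ∈ oneTo (2 * m + 1) → a ≤ m
    bound κ a m x∈ = digits-≤⁻ κ (≤-trans (proj₂ (∈-oneTo⁻ (2 * m + 1) x∈)) (≤-reflexive (+-comm (2 * m) 1)))

2≤digits : ∀ κ a → 2 ≤ digits κ (suc a)
2≤digits κ a = ≤-trans (*-monoʳ-≤ 2 (s≤s z≤n)) (m≤n+m (2 * suc a) (bit κ))

aztec-inner-∈ : ∀ κ {a m} → 3 + a ≤ m → digits κ (suc a) ∈ oneTo (2 * m + 1)
aztec-inner-∈ κ {a} a≤ = ∈-oneTo⁺ (≤-trans (n≤1+n 1) (2≤digits κ a))
  (≤-trans (<⇒≤ (digits-< κ (≤-trans (n≤1+n _) a≤))) (m≤m+n _ 1))

aztec-inner : ∀ κ {a m} → 3 + a ≤ m →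
              OnlyPreimage (merge 1 (2 * m + 1)) (digits κ (suc a)) (digits κ (suc a))
aztec-inner κ {a} a≤ = merge-OnlyPreimage (>⇒≢ (2≤digits κ a))
  (<⇒≢ (≤-trans (digits-< κ (≤-trans (n≤1+n _) a≤)) (m≤m+n _ 1)))

aztecPeriodic : Periodic aztecDiamond
aztecPeriodic = record
  { kinds          = parities
  ; kinds-unique   = ((λ ()) ∷ []) ∷ [] ∷ []
  ; kinds-exist    = s≤s z≤n
  ; site           = aztecSite
  ; site-injective = λ {(κ , a , b)} {(κ′ , a′ , b′)} eq →
      let κ≡ , a≡ = digits-injective κ (suc a) κ′ (suc a′) (cong proj₁ eq)
          _  , b≡ = digits-injective (not κ) (suc b) (not κ′) (suc b′) (cong proj₂ eq)
      in cong₂ _,_ κ≡ (cong₂ _,_ (suc-injective a≡) (suc-injective b≡))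
  ; local          = λ {κ} {a} {b} {κ′} {a′} {b′} (x~ , y~) →
      digits-local κ a κ′ a′ x~ , digits-local (not κ) b (not κ′) b′ y~
  ; translate      = λ {κ} {a} {b} {κ′} {a′} {b′} s t → ⇔-reflexive
      (cong₂ _×_ (cong (_≡ 1) (shift κ a κ′ a′ s)) (cong (_≡ 1) (shift (not κ) b (not κ′) b′ t)))
  }
  where
  shift : ∀ κ a κ′ a′ s → ∣ digits κ (suc a) - digits κ′ (suc a′) ∣ ≡
                          ∣ digits κ (suc (a + s)) - digits κ′ (suc (a′ + s)) ∣
  shift κ a κ′ a′ s = sym (trans (cong₂ ∣_-_∣ (digits-+ κ a s) (digits-+ κ′ a′ s))
    (∣-∣-shift (digits κ (suc a)) (digits κ′ (suc a′)) (2 * s)))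

aztecWrapping : Wrapping aztecPeriodic
aztecWrapping = record
  { plane-Adj  = ⇔-refl
  ; plane-∈    = λ (κ , a , b) (a≤ , b≤) → ∈-filter⁺ (λ (x , y) → (x + y) % 2 ≟ 1)
      (∈-cartesianProduct⁺ (aztec-inner-∈ κ a≤) (aztec-inner-∈ (not κ) b≤))
      (aztecVertex-odd κ (suc a) (suc b))
  ; plane-size = aztec-size
  ; columns    = λ (κ , a , b) (_ , b≤) → OnlyPreimage-×ʳ (aztec-inner (not κ) b≤)
  ; rows       = λ (κ , a , b) (a≤ , _) → OnlyPreimage-×ˡ (aztec-inner κ a≤)
  }

-- The 8.8.4 lattice

directions-complete : ∀ d → d ∈ directions
directions-complete U = here refl
directions-complete D = there (here refl)
directions-complete L = there (there (here refl))
directions-complete R = there (there (there (here refl)))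

-- `Edge` reduces only when both directions are known, hence the case split. Sites are covered
-- directly, since `2 + (a + s)` is `(2 + a) + s` by definition.
Edge-map : ∀ d d′ {p p′} (s t : ℕ) →
           Edge (d , p) (d′ , p′) →
           Edge (d , proj₁ p + s , proj₂ p + t) (d′ , proj₁ p′ + s , proj₂ p′ + t)
Edge-map U L s t refl = refl
Edge-map U R s t refl = refl
Edge-map D L s t refl = refl
Edge-map D R s t refl = refl
Edge-map D U s t refl = refl
Edge-map R L s t refl = refl
Edge-map U U s t ()
Edge-map U D s t ()
Edge-map D D s t ()
Edge-map L U s t ()
Edge-map L D s t ()
Edge-map L L s t ()
Edge-map L R s t ()
Edge-map R U s t ()
Edge-map R D s t ()
Edge-map R R s t ()

+-cancelʳ-×-≡ : ∀ s t {a b a′ b′ : ℕ} → (a + s , b + t) ≡ (a′ + s , b′ + t) → (a , b) ≡ (a′ , b′)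
+-cancelʳ-×-≡ s t eq = cong₂ _,_ (+-cancelʳ-≡ s _ _ (cong proj₁ eq)) (+-cancelʳ-≡ t _ _ (cong proj₂ eq))

Edge-unmap : ∀ d d′ {p p′} (s t : ℕ) →
             Edge (d , proj₁ p + s , proj₂ p + t) (d′ , proj₁ p′ + s , proj₂ p′ + t) →
             Edge (d , p) (d′ , p′)
Edge-unmap U L s t eq = +-cancelʳ-×-≡ s t eq
Edge-unmap U R s t eq = +-cancelʳ-×-≡ s t eq
Edge-unmap D L s t eq = +-cancelʳ-×-≡ s t eq
Edge-unmap D R s t eq = +-cancelʳ-×-≡ s t eq
Edge-unmap D U s t eq = +-cancelʳ-×-≡ s t eq
Edge-unmap R L s t eq = +-cancelʳ-×-≡ s t eq
Edge-unmap U U s t ()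
Edge-unmap U D s t ()
Edge-unmap D D s t ()
Edge-unmap L U s t ()
Edge-unmap L D s t ()
Edge-unmap L L s t ()
Edge-unmap L R s t ()
Edge-unmap R U s t ()
Edge-unmap R D s t ()
Edge-unmap R R s t ()

Edge-local : ∀ d d′ a b a′ b′ → Edge (d , a , b) (d′ , a′ , b′) → Near a a′ × Near b b′
Edge-local U L a b _ _ refl = near-refl a , near-refl b
Edge-local U R a b _ _ refl = near-refl a , near-refl b
Edge-local D L a b _ _ refl = near-refl a , near-refl b
Edge-local D R a b _ _ refl = near-refl a , near-refl b
Edge-local D U a b _ _ refl = near-suc a , near-refl b
Edge-local R L a b _ _ refl = near-refl a , near-suc b
Edge-local U U _ _ _ _ ()
Edge-local U D _ _ _ _ ()
Edge-local D D _ _ _ _ ()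
Edge-local L U _ _ _ _ ()
Edge-local L D _ _ _ _ ()
Edge-local L L _ _ _ _ ()
Edge-local L R _ _ _ _ ()
Edge-local R U _ _ _ _ ()
Edge-local R D _ _ _ _ ()
Edge-local R R _ _ _ _ ()

-- Index 1 is avoided: there `U` or `L` is missing, and the last row or column is glued onto it.
squareSite : Direction × ℕ × ℕ → Direction × ℕ × ℕ
squareSite (d , a , b) = d , 2 + a , 2 + b

squareSite-injective : ∀ {x y} → squareSite x ≡ squareSite y → x ≡ y
squareSite-injective refl = refl

squares-size : ∀ m n → ∣V squaresAndOctagons m n ∣ ≤ 4 * (suc m * suc n)
squares-size m n = begin
  ∣V squaresAndOctagons m n ∣        ≤⟨ List.length-filter (present? m n) (cartesianProduct directions pairs) ⟩
  length (cartesianProduct directions pairs)  ≡⟨ length-cartesianProduct directions pairs ⟩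
  4 * length pairs                   ≡⟨ cong (4 *_) (length-cartesianProduct (oneTo m) (oneTo n)) ⟩
  4 * (length (oneTo m) * length (oneTo n))
    ≡⟨ cong (4 *_) (cong₂ _*_ (length-oneTo m) (length-oneTo n)) ⟩
  4 * (m * n)                        ≤⟨ *-monoʳ-≤ 4 (*-mono-≤ (n≤1+n m) (n≤1+n n)) ⟩
  4 * (suc m * suc n)                ∎
  where
  open ≤-Reasoning
  pairs = cartesianProduct (oneTo m) (oneTo n)

squareSite-present : ∀ {m n} d {a b} → 3 + a ≤ m → 3 + b ≤ n → Present m n (squareSite (d , a , b))
squareSite-present U a≤ b≤ = s≤s (s≤s z≤n)
squareSite-present D a≤ b≤ = a≤
squareSite-present L a≤ b≤ = s≤s (s≤s z≤n)
squareSite-present R a≤ b≤ = b≤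

square-inner : ∀ {a l} → 3 + a ≤ l → OnlyPreimage (merge 1 l) (2 + a) (2 + a)
square-inner a≤ = merge-OnlyPreimage (λ ()) (<⇒≢ a≤)

-- Gluing acts differently on the directions but never changes them, so a preimage of `(d , p)` has
-- direction `d` and only the map `f` for that direction matters.
OnlyPreimage-Direction : ∀ d {f : ℕ × ℕ → ℕ × ℕ} {p} (g : Direction × ℕ × ℕ → Direction × ℕ × ℕ) →
                         (∀ u → proj₁ (g u) ≡ proj₁ u) → (∀ q → g (d , q) ≡ (d , f q)) →
                         OnlyPreimage f p p → OnlyPreimage g (d , p) (d , p)
OnlyPreimage-Direction d {f} {p} g keeps g≡ (fp≡p , only) =
  trans (g≡ p) (cong (d ,_) fp≡p) , λ { (d′ , q) eq → unglue d′ q (trans (sym (keeps (d′ , q))) (cong proj₁ eq)) eq }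
  where
  unglue : ∀ d′ q → d′ ≡ d → g (d′ , q) ≡ (d , p) → (d′ , q) ≡ (d , p)
  unglue d′ q refl eq = cong (d ,_) (only q (cong proj₂ (trans (sym (g≡ q)) eq)))

id-OnlyPreimage : ∀ {A : Set} {a : A} → OnlyPreimage id a a
id-OnlyPreimage = refl , λ _ eq → eq

eightEightFourPeriodic : Periodic eightEightFour
eightEightFourPeriodic = record
  { kinds          = directions
  ; kinds-unique   = directions-unique
  ; kinds-exist    = s≤s z≤n
  ; site           = squareSite
  ; site-injective = squareSite-injective
  ; local          = local
  ; translate      = λ {d} {_} {_} {d′} s t → mk⇔
      (Sum.map (Edge-map d d′ s t) (Edge-map d′ d s t))
      (Sum.map (Edge-unmap d d′ s t) (Edge-unmap d′ d s t))
  }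
  where
  local : ∀ {d a b d′ a′ b′} →
          Edge (squareSite (d , a , b)) (squareSite (d′ , a′ , b′)) ⊎
          Edge (squareSite (d′ , a′ , b′)) (squareSite (d , a , b)) →
          Near a a′ × Near b b′
  local {d} {a} {b} {d′} {a′} {b′} (inj₁ edge) =
    Edge-local d d′ (2 + a) (2 + b) (2 + a′) (2 + b′) edge
  local {d} {a} {b} {d′} {a′} {b′} (inj₂ edge)
    with a~ , b~ ← Edge-local d′ d (2 + a′) (2 + b′) (2 + a) (2 + b) edge =
    near-sym a′ a a~ , near-sym b′ b b~

eightEightFourWrapping : Wrapping eightEightFourPeriodic
eightEightFourWrapping = record
  { plane-Adj  = ⇔-refl
  ; plane-∈    = λ {m} {n} (d , a , b) (a≤ , b≤) → ∈-filter⁺ (present? m n)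
      (∈-cartesianProduct⁺ (directions-complete d)
        (∈-cartesianProduct⁺ (∈-oneTo⁺ (s≤s z≤n) (≤-trans (n≤1+n _) a≤))
                             (∈-oneTo⁺ (s≤s z≤n) (≤-trans (n≤1+n _) b≤))))
      (squareSite-present d a≤ b≤)
  ; plane-size = squares-size
  ; columns    = columns
  ; rows       = rows
  }
  where
  glueColumns-direction : ∀ m n u → proj₁ (glueColumns eightEightFour m n u) ≡ proj₁ u
  glueColumns-direction m n (U , _) = refl
  glueColumns-direction m n (D , _) = refl
  glueColumns-direction m n (L , _) = refl
  glueColumns-direction m n (R , _) = refl

  glueRows-direction : ∀ m n u → proj₁ (glueRows eightEightFour m n u) ≡ proj₁ u
  glueRows-direction m n (U , _) = refl
  glueRows-direction m n (D , _) = refl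
  glueRows-direction m n (L , _) = refl
  glueRows-direction m n (R , _) = refl

  columns : ∀ {m n} x → Periodic.Inside eightEightFourPeriodic m n x →
            OnlyPreimage (glueColumns eightEightFour m n) (squareSite x) (squareSite x)
  columns {m} {n} (d , a , b) (_ , b≤) = lift d
    where
    lift : ∀ d → OnlyPreimage (glueColumns eightEightFour m n) (squareSite (d , a , b)) (squareSite (d , a , b))
    lift U = OnlyPreimage-Direction U _ (glueColumns-direction m n) (λ _ → refl) (OnlyPreimage-×ʳ (square-inner b≤))
    lift D = OnlyPreimage-Direction D _ (glueColumns-direction m n) (λ _ → refl) (OnlyPreimage-×ʳ (square-inner b≤))
    lift L = OnlyPreimage-Direction L _ (glueColumns-direction m n) (λ _ → refl) id-OnlyPreimage
    lift R = OnlyPreimage-Direction R _ (glueColumns-direction m n) (λ _ → refl) id-OnlyPreimage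

  rows : ∀ {m n} x → Periodic.Inside eightEightFourPeriodic m n x →
         OnlyPreimage (glueRows eightEightFour m n) (squareSite x) (squareSite x)
  rows {m} {n} (d , a , b) (a≤ , _) = lift d
    where
    lift : ∀ d → OnlyPreimage (glueRows eightEightFour m n) (squareSite (d , a , b)) (squareSite (d , a , b))
    lift U = OnlyPreimage-Direction U _ (glueRows-direction m n) (λ _ → refl) id-OnlyPreimage
    lift D = OnlyPreimage-Direction D _ (glueRows-direction m n) (λ _ → refl) id-OnlyPreimage
    lift L = OnlyPreimage-Direction L _ (glueRows-direction m n) (λ _ → refl) (OnlyPreimage-×ˡ (square-inner a≤))
    lift R = OnlyPreimage-Direction R _ (glueRows-direction m n) (λ _ → refl) (OnlyPreimage-×ˡ (square-inner a≤))

mainTheorem3 : (Λ : Lattice) →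
    ∃[ η ] ( (λ m n → entropyTerm (plane    Λ m n)) ⟶ η
    × (λ m n → entropyTerm (cylinder Λ m n)) ⟶ η
    × (λ m n → entropyTerm (torus    Λ m n)) ⟶ η )
mainTheorem3 quadratic        = Wrapping.entropies-agree quadraticWrapping
mainTheorem3 crossedQuadratic = Wrapping.entropies-agree crossedWrapping
mainTheorem3 aztecDiamond     = Wrapping.entropies-agree aztecWrapping
mainTheorem3 eightEightFour   = Wrapping.entropies-agree eightEightFourWrapping
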